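{- Let $N$ and $v$ be integers with $2\le v\le N$, let $f=\lfloor\frac{N+1}{v}\rfloor$ and $d=(f+1)v-N$, and let \[\Lambda(N,v)=\Big\lfloor\tfrac{1}{d}\sum_{i=f-d+2}^{f}(f+1-i)\tbinom{N}{i}\Big\rfloor+\sum_{i=0}^{f-d+1}\tbinom{N}{i}.\] Then $\mathrm{LAK}_{(\bar1,1)}(N,v)=\Lambda(N,v)$ if $d\ge f+2$ and $\sum_{i=0}^{f}(f+1-i)\binom{N}{i}\equiv x\pmod d$ for some $x\in\{f+1,\dots,d-1\}$; otherwise $\mathrm{LAK}_{(\bar1,1)}(N,v)=\Lambda(N,v)-1$.
   Context: Binomial coefficients with negative lower index are $0$; empty sums are $0$. For an $N\times k$ array $A$ with entries in each column from a $v$-element symbol set, and column $\gamma$, symbol $\sigma$, let $\rho_A(\{(\gamma,\sigma)\})=\{r:A_{r\gamma}=\sigma\}$; for a set $\mathcal T$ of such 1-way interactions, $\rho_A(\mathcal T)=\bigcup_{T\in\mathcal T}\rho_A(T)$, with $\rho_A(\emptyset)=\emptyset$. $A$ is a $(\bar1,1)$-locating array if for all sets $\mathcal T_1,\mathcal T_2$ of 1-way interactions with $|\mathcal T_1|\le1$, $|\mathcal T_2|\le1$, $\rho_A(\mathcal T_1)=\rho_A(\mathcal T_2)\iff\mathcal T_1=\mathcal T_2$. $\mathrm{LAK}_{(\bar1,1)}(N,v)$ is the largest $k$ for which a $(\bar1,1)$-locating array with $N$ rows, $k$ columns and $v$ symbols exists. -}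

module Defs where

open import Data.Nat using (ℕ; zero; suc; _+_; _*_; _∸_; _≤_; _<_; NonZero; >-nonZero; _/_; _%_)
open import Data.Nat.Properties using (n<1+n; +-monoˡ-<; <-trans; ≡-irrelevant; m<n⇒0<n∸m)
open import Data.Nat.DivMod using (m≡m%n+[m/n]*n; m%n<n)
open import Data.Nat.Combinatorics using (_C_)
open import Data.Fin using (Fin)
open import Data.Fin.Subset using (Subset; ⊥)
open import Data.Fin.Properties using (_≟_)
open import Data.Vec using (tabulate)
open import Data.Maybe using (Maybe; just; nothing)
open import Data.Product using (_×_; _,_; Σ)
open import Function.Bundles using (_⇔_)
open import Relation.Nullary.Decidable using (⌊_⌋)
open import Relation.Binary.PropositionalEquality using (_≡_; subst; sym)

Array : ℕ → ℕ → ℕ → Set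
Array N k v = Fin N → Fin k → Fin v

Interaction : ℕ → ℕ → Set
Interaction k v = Fin k × Fin v

-- A set of 1-way interactions of size at most 1: either ∅ (nothing)
-- or a singleton {T} (just T).
AtMostOne : ℕ → ℕ → Set
AtMostOne k v = Maybe (Interaction k v)

ρ : ∀ {N k v} → Array N k v → AtMostOne k v → Subset N
ρ A nothing        = ⊥
ρ A (just (γ , σ)) = tabulate (λ r → ⌊ A r γ ≟ σ ⌋)

IsLocating : ∀ {N k v} → Array N k v → Set
IsLocating {N} {k} {v} A =
  (T₁ T₂ : AtMostOne k v) → (ρ A T₁ ≡ ρ A T₂) ⇔ (T₁ ≡ T₂)

IsLAK : ℕ → ℕ → ℕ → Set
IsLAK N v L =
  Σ (Array N L v) IsLocating ×
  ((k : ℕ) (A : Array N k v) → IsLocating A → k ≤ L)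

sumTo : ℕ → (ℕ → ℕ) → ℕ
sumTo zero    g = g 0
sumTo (suc n) g = sumTo n g + g (suc n)

[_≤ᵇ_] : ℕ → ℕ → ℕ
[ zero  ≤ᵇ n     ] = 1
[ suc m ≤ᵇ zero  ] = 0
[ suc m ≤ᵇ suc n ] = [ m ≤ᵇ n ]

module _ (N v : ℕ) .{{_ : NonZero v}} where

  f : ℕ
  f = (N + 1) / v

  d : ℕ
  d = (f + 1) * v ∸ N

  -- d is always positive: N < N + 1 = (N+1) % v + f*v < v + f*v = (f+1)*v.
  private
    N<fv : N < (f + 1) * v
    N<fv = <-trans (subst (N <_) (m≡m%n+[m/n]*n (N + 1) v) (subst (N <_) (sym (+-comm1 N)) (n<1+n N)))
                     (subst ((N + 1) % v + f * v <_) (fv≡ f) (+-monoˡ-< (f * v) (m%n<n (N + 1) v)))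
      where
      open import Data.Nat.Properties using (+-comm; *-comm)
      +-comm1 : ∀ n → n + 1 ≡ suc n
      +-comm1 n = +-comm n 1
      fv≡ : ∀ x → v + x * v ≡ (x + 1) * v
      fv≡ x = subst (λ y → v + x * v ≡ y * v) (+-comm 1 x) _≡_.refl

  instance
    d-nonZero : NonZero d
    d-nonZero = >-nonZero (m<n⇒0<n∸m N<fv)

  -- Σ_{i=f-d+2}^{f} (f+1-i) C(N,i); indices i < 0 contribute 0
  -- (binomial with negative lower index), so only 0 ≤ i ≤ f with
  -- f + 2 ≤ i + d are summed.
  S₁ : ℕ
  S₁ = sumTo f (λ i → [ f + 2 ≤ᵇ i + d ] * ((f + 1 ∸ i) * (N C i)))

  -- Σ_{i=0}^{f-d+1} C(N,i); empty (= 0) when f - d + 1 < 0, i.e. only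
  -- 0 ≤ i ≤ f with i + d ≤ f + 1 are summed.
  S₂ : ℕ
  S₂ = sumTo f (λ i → [ i + d ≤ᵇ f + 1 ] * (N C i))

  Λ : ℕ
  Λ = S₁ / d + S₂

  S : ℕ
  S = sumTo f (λ i → (f + 1 ∸ i) * (N C i))

  Condition : Set
  Condition = (f + 2 ≤ d) × Σ ℕ (λ x → (f + 1 ≤ x) × (x ≤ d ∸ 1) × (S % d ≡ x % d))

{-# OPTIONS --safe #-}

-- An array is (1̄,1)-locating iff the symbol classes of its columns are nonempty and pairwise distinct, so the question is how
-- many partitions of an N-set into v nonempty parts can be formed without repeating a part. Charge a part of size t the amount
-- min(d, (f+1) ∸ t). Every partition pays at least d, because (f+1)v = N + d, and each subset pays at most once; this bounds
-- the number of columns by B = ⌊ Σ_{1≤i≤f} min(d, f+1−i) C(N,i) / d ⌋. The sums in Λ also contain the term i = 0, so that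
-- B is Λ − 1, or Λ if the remainder modulo d absorbs that term.
-- Conversely, by a theorem of Baranyai type, B partitions with prescribed part sizes exist as soon as no size i is used more than
-- C(N,i) times. Suitable sizes are found by putting every set of size below f once into a column, as its only such part if
-- possible, and filling up with parts of size f and f + 1 (or one larger part, if the small part is very small).

module Submission where

open import Defs hiding (f; d; S)
open import Data.Bool using (Bool; true; false; _∧_; _∨_; not; if_then_else_)
open import Data.Bool.ListAction using (all)
open import Data.Bool.Properties using (∧-identityʳ)
open import Data.Fin using (Fin; zero; suc; toℕ; fromℕ<; splitAt; _↑ˡ_; _↑ʳ_)
import Data.Fin.Properties as Fin
open import Data.Fin.Subset using (Subset; ⊥; _∪_; _∩_; ∣_∣)
open import Data.Fin.Subset.Properties using (anySubset?; ∪-comm; ∩-comm)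
open import Data.List as List using (List; []; _∷_; _++_; map; filter; allFin; replicate; length)
open import Data.List.Membership.Propositional using (_∈_)
open import Data.List.Membership.Propositional.Properties using (∈-map⁺; ∈-map⁻; ∈-filter⁺; ∈-filter⁻; ∈-allFin; ∈-lookup)
open import Data.List.Relation.Unary.All as All using (All; []; _∷_)
open import Data.List.Relation.Unary.All.Properties using (++⁺; replicate⁺)
open import Data.List.Relation.Unary.Any using (here; there)
open import Data.Maybe using (just; nothing)
open import Data.Nat hiding (_≤ᵇ_)
open import Data.Nat.Combinatorics using (_C_; nCn≡1; nCk≡nC[n∸k]; nCk+nC[k+1]≡[n+1]C[k+1]; k>n⇒nCk≡0)
open import Data.Nat.DivMod using (m≡m%n+[m/n]*n; m%n<n; m/n*n≤m; m≥n⇒m/n>0; [m+kn]%n≡m%n; m<n⇒m%n≡m)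
open import Data.Nat.Properties
open import Data.Nat.Tactic.RingSolver using (solve-∀)
open import Data.Product using (Σ; ∃; _×_; _,_; proj₁; proj₂)
open import Data.Sum using (_⊎_; inj₁; inj₂; [_,_]′; map₂)
open import Data.Vec using ([]; _∷_; lookup; tabulate)
open import Data.Vec.Properties using (lookup-zipWith; lookup-replicate; lookup∘tabulate)
open import Function using (_∘_; Equivalence; mk⇔)
open import Relation.Binary.Definitions using (tri<; tri≈; tri>)
open import Relation.Binary.PropositionalEquality hiding ([_])
open import Relation.Nullary using (¬_; yes; no; contradiction)
open import Relation.Nullary.Decidable using (⌊_⌋)

open import Algebra.Properties.Semiring.Sum +-*-semiring
  using (sum; sum-cong-≗; ∑-distrib-+; ∑-comm; *-distribˡ-sum; *-distribʳ-sum)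

-- What has to be checked is mainly size f + 1, and this takes inequalities between binomial
-- coefficients; for d = 2 and for d = v + 1 = 3 the oversized parts enter the count. Always 2 ≤ d ≤
-- v + 1. A column with parts of sizes f and f + 1 only exists unless d = v + 1. In that exceptional
-- case every column needs a part of size below f, there are at least as many such sets as columns,
-- and the surplus goes into columns with two parts of size f - 1. In the Baranyai part, two parts
-- share a class only if they had the same size to begin with and agree on all elements placed so
-- far. So distinctness is not carried along: it is what the counting bound says once no element is
-- left, as C(0, 0) = 1.

private variable
  n k l m : ℕ

-- Rado's theorem on transversals

𝟙 : Bool → ℕ
𝟙 b = if b then 1 else 0

Submodular Supermodular : (Subset n → ℕ) → Set
Submodular   c = ∀ X Y → c (X ∪ Y) + c (X ∩ Y) ≤ c X + c Y
Supermodular e = ∀ X Y → e X + e Y ≤ e (X ∪ Y) + e (X ∩ Y)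

𝟙-not : ∀ b → 𝟙 b + 𝟙 (not b) ≡ 1
𝟙-not true  = refl
𝟙-not false = refl

all-∨ : ∀ {A : Set} (p q : A → Bool) xs → all p xs ≡ true → all (λ x → p x ∨ q x) xs ≡ true
all-∨ p q []       _ = refl
all-∨ p q (x ∷ xs) h with p x
... | true = all-∨ p q xs h

all-∨ʳ : ∀ {A : Set} (p q : A → Bool) xs → all q xs ≡ true → all (λ x → p x ∨ q x) xs ≡ true
all-∨ʳ p q []       _ = refl
all-∨ʳ p q (x ∷ xs) h with p x | q x
... | true  | true = all-∨ʳ p q xs h
... | false | true = all-∨ʳ p q xs h

𝟙-mono : ∀ {a b} → (a ≡ true → b ≡ true) → 𝟙 a ≤ 𝟙 b
𝟙-mono {false} _ = z≤n
𝟙-mono {true}  h rewrite h refl = ≤-refl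

𝟙-all-supermodular : ∀ {A : Set} (p q : A → Bool) xs →
  𝟙 (all p xs) + 𝟙 (all q xs) ≤ 𝟙 (all (λ x → p x ∨ q x) xs) + 𝟙 (all (λ x → p x ∧ q x) xs)
𝟙-all-supermodular p q []       = ≤-refl
𝟙-all-supermodular p q (x ∷ xs) with p x | q x
... | true  | true  = 𝟙-all-supermodular p q xs
... | true  | false = +-monoˡ-≤ 0 (𝟙-mono (all-∨ p q xs))
... | false | true  = subst (𝟙 (all q xs) ≤_) (sym (+-identityʳ _)) (𝟙-mono (all-∨ʳ p q xs))
... | false | false = z≤n

_⊆?_ : List (Fin n) → Subset n → Bool
js ⊆? X = all (lookup X) js

all-cong : ∀ {A : Set} {p q : A → Bool} → (∀ x → p x ≡ q x) → ∀ xs → all p xs ≡ all q xs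
all-cong h []       = refl
all-cong h (x ∷ xs) = cong₂ _∧_ (h x) (all-cong h xs)

⊆?-supermodular : (js : List (Fin n)) → Supermodular (λ X → 𝟙 (js ⊆? X))
⊆?-supermodular js X Y
  rewrite all-cong (λ j → lookup-zipWith _∨_ j X Y) js
        | all-cong (λ j → lookup-zipWith _∧_ j X Y) js
  = 𝟙-all-supermodular (lookup X) (lookup Y) js

+-supermodular : ∀ (e e′ : Subset n → ℕ) → Supermodular e → Supermodular e′ → Supermodular (λ X → e X + e′ X)
+-supermodular e e′ s s′ X Y = begin
  (e X + e′ X) + (e Y + e′ Y)                         ≡⟨ swap (e X) (e′ X) (e Y) (e′ Y) ⟩
  (e X + e Y) + (e′ X + e′ Y)                         ≤⟨ +-mono-≤ (s X Y) (s′ X Y) ⟩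
  (e (X ∪ Y) + e (X ∩ Y)) + (e′ (X ∪ Y) + e′ (X ∩ Y)) ≡⟨ swap (e (X ∪ Y)) _ _ _ ⟩
  (e (X ∪ Y) + e′ (X ∪ Y)) + (e (X ∩ Y) + e′ (X ∩ Y)) ∎
  where
  open ≤-Reasoning
  swap : ∀ a b c d → (a + b) + (c + d) ≡ (a + c) + (b + d)
  swap = solve-∀

sum-⊆?-supermodular : (R : Fin k → List (Fin n)) → Supermodular (λ X → sum (λ r → 𝟙 (R r ⊆? X)))
sum-⊆?-supermodular {k = zero}  R X Y = z≤n
sum-⊆?-supermodular {k = suc k} R =
  +-supermodular (λ X → 𝟙 (R zero ⊆? X)) (λ X → sum (λ r → 𝟙 (R (suc r) ⊆? X))) (⊆?-supermodular (R zero)) (sum-⊆?-supermodular (R ∘ suc))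

module Rado (c : Subset n → ℕ) (c-sub : Submodular c) (c⊥ : c ⊥ ≡ 0) where

  -- If dropping a from the choices of a row violates the bound at X, and dropping b violates it at Y,
  -- then uncrossing X and Y violates the original bound at X ∪ Y or at X ∩ Y.
  drop-one : ∀ (e : Subset n → ℕ) → Supermodular e → ∀ a b js →
    (∀ X → e X + 𝟙 ((a ∷ b ∷ js) ⊆? X) ≤ c X) →
    ∀ {X Y} → c X < e X + 𝟙 ((a ∷ js) ⊆? X) → ¬ (c Y < e Y + 𝟙 ((b ∷ js) ⊆? Y))
  drop-one e e-sup a b js h {X} {Y} vX vY
    with (a ∷ js) ⊆? X in eX | (b ∷ js) ⊆? Y in eY
  ... | false | _     = <-irrefl refl (<-≤-trans vX (≤-trans (+-monoʳ-≤ (e X) z≤n) (h X)))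
  ... | true  | false = <-irrefl refl (<-≤-trans vY (≤-trans (+-monoʳ-≤ (e Y) z≤n) (h Y)))
  ... | true  | true  = <-irrefl refl (begin-strict
    c (X ∪ Y) + c (X ∩ Y)                              ≤⟨ c-sub X Y ⟩
    c X + c Y                                          ≤⟨ +-mono-≤ (weaken X vX) (weaken Y vY) ⟩
    e X + e Y                                          ≤⟨ e-sup X Y ⟩
    e (X ∪ Y) + e (X ∩ Y)                              <⟨ +-mono-<-≤ e<c (≤-trans (m≤m+n _ _) (h (X ∩ Y))) ⟩
    c (X ∪ Y) + c (X ∩ Y)                              ∎)
    where
    open ≤-Reasoning
    weaken : ∀ Z → c Z < e Z + 1 → c Z ≤ e Z
    weaken Z l = s≤s⁻¹ (subst (c Z <_) (+-comm (e Z) 1) l)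
    abjs⊆ : (a ∷ b ∷ js) ⊆? (X ∪ Y) ≡ true
    abjs⊆ rewrite all-cong (λ j → lookup-zipWith _∨_ j X Y) (a ∷ b ∷ js)
      with lookup X a | lookup Y b
    ... | true | true with lookup X b
    ... | true  = all-∨ (lookup X) (lookup Y) js eX
    ... | false = all-∨ (lookup X) (lookup Y) js eX
    e<c : e (X ∪ Y) < c (X ∪ Y)
    e<c = subst (_≤ c (X ∪ Y)) (trans (cong (λ z → e (X ∪ Y) + 𝟙 z) abjs⊆) (+-comm _ 1)) (h (X ∪ Y))

  -- The choices of one row shrink by one element at a time: if the bound fails somewhere without
  -- `b`, then `drop-one` lets `a` go instead.
  choose-one : ∀ (e : Subset n → ℕ) → Supermodular e → ∀ a js →
    (∀ X → e X + 𝟙 ((a ∷ js) ⊆? X) ≤ c X) →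
    ∃ λ p → p ∈ a ∷ js × (∀ X → e X + 𝟙 (lookup X p) ≤ c X)
  choose-one e e-sup a [] h = a , here refl , λ X →
    subst (λ b → e X + 𝟙 b ≤ c X) (∧-identityʳ (lookup X a)) (h X)
  choose-one e e-sup a (b ∷ js) h
    with anySubset? (λ X → suc (c X) ≤? e X + 𝟙 ((a ∷ js) ⊆? X))
  ... | no ok with choose-one e e-sup a js (λ X → ≮⇒≥ (λ l → ok (X , l)))
  ...   | p , here eq , hp = p , here eq , hp
  ...   | p , there i , hp = p , there (there i) , hp
  choose-one e e-sup a (b ∷ js) h | yes (X , vX)
    with choose-one e e-sup b js (λ Y → ≮⇒≥ (drop-one e e-sup a b js h vX))
  ... | p , i , hp = p , there i , hp

  -- The hypothesis counts the rows that are forced to choose inside `X`. Rows are settled one by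
  -- one: the pending rows are kept in the supermodular part while one row is cut down to a single
  -- element, which then joins `e`.
  rado : ∀ {k} (R : Fin k → List (Fin n)) (e : Subset n → ℕ) → Supermodular e →
    (∀ X → e X + sum (λ r → 𝟙 (R r ⊆? X)) ≤ c X) →
    Σ (Fin k → Fin n) λ p → (∀ r → p r ∈ R r) × (∀ X → e X + sum (λ r → 𝟙 (lookup X (p r))) ≤ c X)
  rado {zero}  R e e-sup h = (λ ()) , (λ ()) , h
  rado {suc k} R e e-sup h with R zero in eq
  -- A row without choices lies in `⊥` and would violate the bound there.
  ... | [] = contradiction
    (≤-trans (m≤n+m 1 (e ⊥)) (≤-trans (+-monoʳ-≤ (e ⊥) (m≤m+n 1 _)) (≤-trans (h ⊥) (≤-reflexive c⊥)))) λ ()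
  ... | a ∷ js
    with choose-one (λ X → e X + sum (λ r → 𝟙 (R (suc r) ⊆? X)))
                    (+-supermodular e _ e-sup (sum-⊆?-supermodular (R ∘ suc))) a js
                    (λ X → ≤-trans (≤-reflexive (swap (e X) _ _)) (h X))
    where
    swap : ∀ x y z → (x + y) + z ≡ x + (z + y)
    swap = solve-∀
  ... | p₀ , i₀ , h₀
    with rado (R ∘ suc) (λ X → e X + 𝟙 (lookup X p₀)) (+-supermodular e _ e-sup singleton-supermodular)
              (λ X → ≤-trans (≤-reflexive (swap (e X) _ _)) (h₀ X))
    where
    swap : ∀ x y z → (x + y) + z ≡ (x + z) + y
    swap = solve-∀
    singleton-supermodular : Supermodular (λ X → 𝟙 (lookup X p₀))
    singleton-supermodular X Y =
      subst₂ _≤_ (cong₂ _+_ (single X) (single Y)) (cong₂ _+_ (single (X ∪ Y)) (single (X ∩ Y)))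
             (⊆?-supermodular (p₀ ∷ []) X Y)
      where
      single : ∀ Z → 𝟙 ((p₀ ∷ []) ⊆? Z) ≡ 𝟙 (lookup Z p₀)
      single Z = cong 𝟙 (∧-identityʳ (lookup Z p₀))
  ... | p , i , hp = q , j , λ X → ≤-trans (≤-reflexive (sym (+-assoc (e X) _ _))) (hp X)
    where
    q : Fin (suc k) → Fin n
    q zero    = p₀
    q (suc r) = p r
    j : ∀ r → q r ∈ R r
    j zero    = subst (p₀ ∈_) (sym eq) i₀
    j (suc r) = i r

-- Sums over finite sets

nC0≡1 : ∀ n → n C 0 ≡ 1
nC0≡1 n = trans (nCk≡nC[n∸k] {0} {n} z≤n) (nCn≡1 n)

absorption : ∀ n k → suc k * (suc n C suc k) ≡ suc n * (n C k)
absorption zero    zero    = refl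
absorption zero    (suc k)
  rewrite k>n⇒nCk≡0 {1} {suc (suc k)} (s≤s (s≤s z≤n)) | k>n⇒nCk≡0 {0} {suc k} (s≤s z≤n) = *-zeroʳ (suc (suc k))
absorption (suc n) zero    = begin
  1 * (suc (suc n) C 1)       ≡⟨ cong (1 *_) (nCk+nC[k+1]≡[n+1]C[k+1] (suc n) 0) ⟨
  1 * (suc n C 0 + suc n C 1) ≡⟨ *-distribˡ-+ 1 (suc n C 0) (suc n C 1) ⟩
  1 * (suc n C 0) + 1 * (suc n C 1) ≡⟨ cong₂ _+_ (cong (1 *_) (nC0≡1 (suc n))) (absorption n 0) ⟩
  1 + suc n * (n C 0)         ≡⟨ cong (λ z → 1 + suc n * z) (trans (nC0≡1 n) (sym (nC0≡1 (suc n)))) ⟩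
  1 + suc n * (suc n C 0)     ≡⟨ cong (_+ suc n * (suc n C 0)) (nC0≡1 (suc n)) ⟨
  suc (suc n) * (suc n C 0)   ∎
  where open ≡-Reasoning
absorption (suc n) (suc k) = begin
  suc (suc k) * (suc (suc n) C suc (suc k))
    ≡⟨ cong (suc (suc k) *_) (nCk+nC[k+1]≡[n+1]C[k+1] (suc n) (suc k)) ⟨
  suc (suc k) * (suc n C suc k + suc n C suc (suc k))
    ≡⟨ expand k (suc n C suc k) (suc n C suc (suc k)) ⟩
  suc n C suc k + (suc k * (suc n C suc k) + suc (suc k) * (suc n C suc (suc k)))
    ≡⟨ cong (suc n C suc k +_) (cong₂ _+_ (absorption n k) (absorption n (suc k))) ⟩
  suc n C suc k + (suc n * (n C k) + suc n * (n C suc k))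
    ≡⟨ cong (suc n C suc k +_) (*-distribˡ-+ (suc n) (n C k) (n C suc k)) ⟨
  suc n C suc k + suc n * (n C k + n C suc k)
    ≡⟨ cong (λ z → suc n C suc k + suc n * z) (nCk+nC[k+1]≡[n+1]C[k+1] n k) ⟩
  suc (suc n) * (suc n C suc k) ∎
  where
  open ≡-Reasoning
  expand : ∀ k x y → suc (suc k) * (x + y) ≡ x + (suc k * x + suc (suc k) * y)
  expand = solve-∀

sum-mono : {f g : Fin n → ℕ} → (∀ i → f i ≤ g i) → sum f ≤ sum g
sum-mono {zero}  h = z≤n
sum-mono {suc n} h = +-mono-≤ (h zero) (sum-mono (h ∘ suc))

sum-const : ∀ n x → sum {n} (λ _ → x) ≡ n * x
sum-const zero    x = refl
sum-const (suc n) x = cong (x +_) (sum-const n x)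

term≤sum : (h : Fin n → ℕ) → ∀ i → h i ≤ sum h
term≤sum h zero    = m≤m+n _ _
term≤sum h (suc i) = ≤-trans (term≤sum (h ∘ suc) i) (m≤n+m _ _)

sum≤1⇒unique : (h : Fin n → ℕ) → sum h ≤ 1 → ∀ i j → 1 ≤ h i → 1 ≤ h j → i ≡ j
sum≤1⇒unique h le zero    zero    _ _ = refl
sum≤1⇒unique h le zero    (suc j) p q =
  contradiction (≤-trans (+-mono-≤ p (≤-trans q (term≤sum (h ∘ suc) j))) le) λ { (s≤s ()) }
sum≤1⇒unique h le (suc i) zero    p q =
  contradiction (≤-trans (+-mono-≤ q (≤-trans p (term≤sum (h ∘ suc) i))) le) λ { (s≤s ()) }
sum≤1⇒unique h le (suc i) (suc j) p q =
  cong suc (sum≤1⇒unique (h ∘ suc) (≤-trans (m≤n+m _ _) le) i j p q)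

δ : Fin n → Fin n → ℕ
δ i j = 𝟙 ⌊ i Fin.≟ j ⌋

δ-refl : (i : Fin n) → δ i i ≡ 1
δ-refl i with i Fin.≟ i
... | yes _ = refl
... | no ¬p = contradiction refl ¬p

δ-suc : (i j : Fin n) → δ (suc i) (suc j) ≡ δ i j
δ-suc i j with i Fin.≟ j
... | yes _ = refl
... | no  _ = refl

sum-δ : (i : Fin n) (h : Fin n → ℕ) → sum (λ j → δ i j * h j) ≡ h i
sum-δ {suc n} zero h = begin
  h zero + 0 + sum (λ (_ : Fin n) → 0) ≡⟨ cong (h zero + 0 +_) (trans (sum-const n 0) (*-zeroʳ n)) ⟩
  h zero + 0 + 0 ≡⟨ trans (+-identityʳ _) (+-identityʳ _) ⟩
  h zero ∎
  where open ≡-Reasoning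
sum-δ {suc n} (suc i) h = trans (sum-cong-≗ (λ j → cong (_* h (suc j)) (δ-suc i j))) (sum-δ i (h ∘ suc))

occurrences : (Fin k → Fin l → Fin m) → Fin m → ℕ
occurrences cls j = sum λ r → sum λ c → δ (cls r c) j

sum-by-class : (cls : Fin k → Fin l → Fin m) (h : Fin m → ℕ) →
  sum (λ r → sum λ c → h (cls r c)) ≡ sum (λ j → h j * occurrences cls j)
sum-by-class cls h = begin
  sum (λ r → sum λ c → h (cls r c))
    ≡⟨ sum-cong-≗ (λ r → sum-cong-≗ λ c → sym (sum-δ (cls r c) h)) ⟩
  sum (λ r → sum λ c → sum λ j → δ (cls r c) j * h j)
    ≡⟨ sum-cong-≗ (λ r → ∑-comm λ c j → δ (cls r c) j * h j) ⟩
  sum (λ r → sum λ j → sum λ c → δ (cls r c) j * h j)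
    ≡⟨ ∑-comm (λ r j → sum λ c → δ (cls r c) j * h j) ⟩
  sum (λ j → sum λ r → sum λ c → δ (cls r c) j * h j)
    ≡⟨ sum-cong-≗ (λ j → sym (trans (*-distribʳ-sum (h j) λ r → sum λ c → δ (cls r c) j)
                                  (sum-cong-≗ λ r → *-distribʳ-sum (h j) λ c → δ (cls r c) j))) ⟩
  sum (λ j → occurrences cls j * h j)
    ≡⟨ sum-cong-≗ (λ j → *-comm (occurrences cls j) (h j)) ⟩
  sum (λ j → h j * occurrences cls j) ∎
  where open ≡-Reasoning

_⟦_⟧ : (Fin m → ℕ) → Subset m → ℕ
F ⟦ X ⟧ = sum λ j → 𝟙 (lookup X j) * F j

-- The set functions U[X] and e + L[X] describe a generalised polymatroid, which is what makes their minimum submodular.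
module Bounds (L U : Fin m → ℕ) (L≤U : ∀ j → L j ≤ U j) (e : ℕ) where

  -- With one choice per row and `e` equal to the number of rows minus the total of `L`, the second
  -- bound says that the complement of `X` receives at least its share of `L`. One set function thus
  -- carries upper and lower bounds.
  c : Subset m → ℕ
  c X = U ⟦ X ⟧ ⊓ (e + L ⟦ X ⟧)

  -- The two sides differ by the sum of `G` - `F` over the elements of `X` outside `Y`.
  uncross : ∀ (F G : Fin m → ℕ) → (∀ j → F j ≤ G j) → ∀ X Y → F ⟦ X ∪ Y ⟧ + G ⟦ X ∩ Y ⟧ ≤ G ⟦ X ⟧ + F ⟦ Y ⟧
  uncross F G F≤G X Y = begin
    F ⟦ X ∪ Y ⟧ + G ⟦ X ∩ Y ⟧
      ≡⟨ ∑-distrib-+ (λ j → 𝟙 (lookup (X ∪ Y) j) * F j) _ ⟨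
    sum (λ j → 𝟙 (lookup (X ∪ Y) j) * F j + 𝟙 (lookup (X ∩ Y) j) * G j)
      ≤⟨ sum-mono pointwise ⟩
    sum (λ j → 𝟙 (lookup X j) * G j + 𝟙 (lookup Y j) * F j)
      ≡⟨ ∑-distrib-+ (λ j → 𝟙 (lookup X j) * G j) _ ⟩
    G ⟦ X ⟧ + F ⟦ Y ⟧ ∎
    where
    open ≤-Reasoning
    pointwise : ∀ j → 𝟙 (lookup (X ∪ Y) j) * F j + 𝟙 (lookup (X ∩ Y) j) * G j ≤ 𝟙 (lookup X j) * G j + 𝟙 (lookup Y j) * F j
    pointwise j rewrite lookup-zipWith _∨_ j X Y | lookup-zipWith _∧_ j X Y
      with lookup X j | lookup Y j
    ... | true  | true  = ≤-reflexive (+-comm (1 * F j) (1 * G j))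
    ... | true  | false = +-monoˡ-≤ 0 (*-monoʳ-≤ 1 (F≤G j))
    ... | false | true  = ≤-reflexive (+-comm (1 * F j) 0)
    ... | false | false = z≤n

  -- Serves the case where the two bounds attain the minimum at one set each: the union is then
  -- compared with the `L` bound and the intersection with the `U` bound.
  mixed : ∀ X Y → c (X ∪ Y) + c (X ∩ Y) ≤ U ⟦ X ⟧ + (e + L ⟦ Y ⟧)
  mixed X Y = begin
    c (X ∪ Y) + c (X ∩ Y)               ≤⟨ +-mono-≤ (m⊓n≤n (U ⟦ X ∪ Y ⟧) _) (m⊓n≤m (U ⟦ X ∩ Y ⟧) _) ⟩
    (e + L ⟦ X ∪ Y ⟧) + U ⟦ X ∩ Y ⟧     ≡⟨ +-assoc e (L ⟦ X ∪ Y ⟧) (U ⟦ X ∩ Y ⟧) ⟩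
    e + (L ⟦ X ∪ Y ⟧ + U ⟦ X ∩ Y ⟧)     ≤⟨ +-monoʳ-≤ e (uncross L U L≤U X Y) ⟩
    e + (U ⟦ X ⟧ + L ⟦ Y ⟧)             ≡⟨ swap e (U ⟦ X ⟧) (L ⟦ Y ⟧) ⟩
    U ⟦ X ⟧ + (e + L ⟦ Y ⟧)             ∎
    where
    open ≤-Reasoning
    swap : ∀ e x y → e + (x + y) ≡ x + (e + y)
    swap = solve-∀

  c-submodular : Submodular c
  c-submodular X Y with ⊓-sel (U ⟦ X ⟧) (e + L ⟦ X ⟧) | ⊓-sel (U ⟦ Y ⟧) (e + L ⟦ Y ⟧)
  ... | inj₁ p | inj₁ q rewrite p | q =
    ≤-trans (+-mono-≤ (m⊓n≤m (U ⟦ X ∪ Y ⟧) _) (m⊓n≤m (U ⟦ X ∩ Y ⟧) _)) (uncross U U (λ _ → ≤-refl) X Y)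
  ... | inj₁ p | inj₂ q rewrite p | q = mixed X Y
  ... | inj₂ p | inj₁ q rewrite p | q = begin
    c (X ∪ Y) + c (X ∩ Y)         ≡⟨ cong₂ (λ A B → c A + c B) (∪-comm X Y) (∩-comm X Y) ⟩
    c (Y ∪ X) + c (Y ∩ X)         ≤⟨ mixed Y X ⟩
    U ⟦ Y ⟧ + (e + L ⟦ X ⟧)       ≡⟨ +-comm (U ⟦ Y ⟧) (e + L ⟦ X ⟧) ⟩
    (e + L ⟦ X ⟧) + U ⟦ Y ⟧       ∎
    where open ≤-Reasoning
  ... | inj₂ p | inj₂ q rewrite p | q =
    ≤-trans (+-mono-≤ (m⊓n≤n (U ⟦ X ∪ Y ⟧) _) (m⊓n≤n (U ⟦ X ∩ Y ⟧) _))
      (≤-trans (≤-reflexive (swap e (L ⟦ X ∪ Y ⟧) e (L ⟦ X ∩ Y ⟧)))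
        (≤-trans (+-monoʳ-≤ (e + e) (uncross L L (λ _ → ≤-refl) X Y))
          (≤-reflexive (swap e e (L ⟦ X ⟧) (L ⟦ Y ⟧)))))
    where
    swap : ∀ a b c d → (a + b) + (c + d) ≡ (a + c) + (b + d)
    swap = solve-∀

  c⊥≡0 : c ⊥ ≡ 0
  c⊥≡0 rewrite trans (sum-cong-≗ {m} (λ j → cong (λ b → 𝟙 b * U j) (lookup-replicate j false)))
                     (trans (sum-const m 0) (*-zeroʳ m)) = refl

-- Baranyai's theorem

all⇒∈ : ∀ {A : Set} (p : A → Bool) {xs x} → all p xs ≡ true → x ∈ xs → p x ≡ true
all⇒∈ p {x ∷ xs} h i with p x in eq
all⇒∈ p {x ∷ xs} h  (here refl) | true = eq
all⇒∈ p {x ∷ xs} h  (there i)   | true = all⇒∈ p h i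

δ-≢ : {i j : Fin n} → ¬ (i ≡ j) → δ i j ≡ 0
δ-≢ {i = i} {j} i≢j with i Fin.≟ j
... | yes i≡j = contradiction i≡j i≢j
... | no  _   = refl

δ-sym : (i j : Fin n) → δ i j ≡ δ j i
δ-sym i j with i Fin.≟ j
... | yes refl = sym (δ-refl i)
... | no  i≢j  = sym (δ-≢ (i≢j ∘ sym))

-- C(n, t − 1), with C(n, −1) = 0.
below : ℕ → ℕ → ℕ
below n zero    = 0
below n (suc t) = n C t

pascal : ∀ n t → below n t + n C t ≡ suc n C t
pascal n zero    = trans (nC0≡1 n) (sym (nC0≡1 (suc n)))
pascal n (suc t) = nCk+nC[k+1]≡[n+1]C[k+1] n t

below-absorption : ∀ n t → t * (suc n C t) ≡ suc n * below n t
below-absorption n zero    = sym (*-zeroʳ (suc n))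
below-absorption n (suc t) = absorption n t

below-bound : ∀ M t {q} → q ≤ suc M C t → t * q ≤ suc M * below M t
below-bound M t q≤ = ≤-trans (*-monoʳ-≤ t q≤) (≤-reflexive (below-absorption M t))

excess≤below : ∀ M t {q} → q ≤ suc M C t → q ∸ M C t ≤ below M t
excess≤below M t {q} q≤ =
  m≤n+o⇒m∸n≤o q (M C t) (≤-trans q≤ (≤-reflexive (trans (sym (pascal M t)) (+-comm (below M t) (M C t)))))

-- The fractional share t q / (M + 1) covers the excess `x` = q - C(M, t), because `x` ≤ C(M, t - 1)
-- and (M + 1 - t) C(M, t - 1) = t C(M, t).
excess-bound : ∀ M t {q} → q ≤ suc M C t → suc M * (q ∸ M C t) ≤ t * q
excess-bound M t {q} q≤ with ≤-total (suc M) t | ≤-total q (M C t)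
... | inj₁ M<t | _ = *-mono-≤ M<t (m∸n≤m q (M C t))
... | inj₂ t≤M | inj₁ q≤C = subst (λ z → suc M * z ≤ t * q) (sym (m≤n⇒m∸n≡0 q≤C))
                              (subst (_≤ t * q) (sym (*-zeroʳ (suc M))) z≤n)
... | inj₂ t≤M | inj₂ C≤q = begin
  suc M * x                  ≡⟨ cong (_* x) (m+[n∸m]≡n t≤M) ⟨
  (t + u) * x                ≡⟨ *-distribʳ-+ x t u ⟩
  t * x + u * x              ≤⟨ +-monoʳ-≤ (t * x) (*-monoʳ-≤ u (excess≤below M t q≤)) ⟩
  t * x + u * below M t      ≡⟨ cong (t * x +_) balance ⟩
  t * x + t * (M C t)        ≡⟨ *-distribˡ-+ t x (M C t) ⟨
  t * (x + M C t)            ≡⟨ cong (t *_) (m∸n+n≡m C≤q) ⟩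
  t * q                      ∎
  where
  open ≤-Reasoning
  x = q ∸ M C t
  u = suc M ∸ t
  balance : u * below M t ≡ t * (M C t)
  balance = +-cancelˡ-≡ (t * below M t) _ _ (trans (sym (*-distribʳ-+ (below M t) t u))
    (trans (cong (_* below M t) (m+[n∸m]≡n t≤M))
    (trans (sym (below-absorption M t))
    (trans (cong (t *_) (sym (pascal M t))) (*-distribˡ-+ t (below M t) (M C t))))))

-- A class consists of the parts with the same elements so far and the same number s of elements still to come. The next element
-- has to join one part of every row. Choosing a part of residual size s with probability s / (M + 1) would keep the invariant
-- in every class on average; Rado's theorem rounds this fractional choice to an actual one.
module Step (M : ℕ) (s : Fin m → ℕ) (cls : Fin k → Fin l → Fin m)
            (row : ∀ r → sum (λ c → s (cls r c)) ≡ suc M)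
            (bound : ∀ j → occurrences cls j ≤ suc M C s j) where

  -- `U` and `L` bound the picks in a class: at most C(M, s - 1) parts may take the next element,
  -- and at most C(M, s) may go without it.
  occ U L : Fin m → ℕ
  occ = occurrences cls
  U j = below M (s j)
  L j = occ j ∸ M C s j

  total : ℕ
  total = sum L

  open Bounds L U (λ j → excess≤below M (s j) (bound j)) (k ∸ total)

  weight : suc M * k ≡ sum (λ j → s j * occ j)
  weight = begin
    suc M * k                           ≡⟨ *-comm (suc M) k ⟩
    k * suc M                           ≡⟨ sum-const k (suc M) ⟨
    sum {k} (λ _ → suc M)               ≡⟨ sum-cong-≗ (λ r → sym (row r)) ⟩
    sum (λ r → sum λ c → s (cls r c))   ≡⟨ sum-by-class cls s ⟩
    sum (λ j → s j * occ j)             ∎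
    where open ≡-Reasoning

  -- Makes the truncated subtraction `k ∸ total` exact.
  total≤k : total ≤ k
  total≤k = *-cancelˡ-≤ (suc M) (begin
    suc M * sum L               ≡⟨ *-distribˡ-sum (suc M) L ⟩
    sum (λ j → suc M * L j)     ≤⟨ sum-mono (λ j → excess-bound M (s j) (bound j)) ⟩
    sum (λ j → s j * occ j)     ≡⟨ weight ⟨
    suc M * k                   ∎)
    where open ≤-Reasoning

  choices : Fin k → List (Fin m)
  choices r = map (cls r) (filter (λ c → 1 ≤? s (cls r c)) (allFin l))

  -- Parts that are no choices are full, so if all choices lie in `X`, the whole residual size
  -- `suc M` of the row does.
  row-bound : ∀ X r → suc M * 𝟙 (choices r ⊆? X) ≤ sum (λ c → 𝟙 (lookup X (cls r c)) * s (cls r c))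
  row-bound X r with choices r ⊆? X in eq
  ... | false = ≤-trans (≤-reflexive (*-zeroʳ (suc M))) z≤n
  ... | true  = begin
    suc M * 1                                        ≡⟨ *-identityʳ (suc M) ⟩
    suc M                                            ≡⟨ row r ⟨
    sum (λ c → s (cls r c))                          ≤⟨ sum-mono pointwise ⟩
    sum (λ c → 𝟙 (lookup X (cls r c)) * s (cls r c)) ∎
    where
    open ≤-Reasoning
    pointwise : ∀ c → s (cls r c) ≤ 𝟙 (lookup X (cls r c)) * s (cls r c)
    pointwise c with 1 ≤? s (cls r c)
    ... | no  s≡0 = ≤-trans (s≤s⁻¹ (≰⇒> s≡0)) z≤n
    ... | yes s>0
      rewrite all⇒∈ (lookup X) eq (∈-map⁺ (cls r) (∈-filter⁺ (λ c → 1 ≤? s (cls r c)) (∈-allFin c) s>0))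
      = ≤-reflexive (sym (*-identityˡ _))

  chosen : Subset m → ℕ
  chosen X = sum (λ r → 𝟙 (choices r ⊆? X))

  chosen-bound : ∀ X → suc M * chosen X ≤ sum (λ j → 𝟙 (lookup X j) * s j * occ j)
  chosen-bound X = begin
    suc M * chosen X                                               ≡⟨ *-distribˡ-sum (suc M) (λ r → 𝟙 (choices r ⊆? X)) ⟩
    sum (λ r → suc M * 𝟙 (choices r ⊆? X))                         ≤⟨ sum-mono (row-bound X) ⟩
    sum (λ r → sum λ c → 𝟙 (lookup X (cls r c)) * s (cls r c))     ≡⟨ sum-by-class cls (λ j → 𝟙 (lookup X j) * s j) ⟩
    sum (λ j → 𝟙 (lookup X j) * s j * occ j)                       ∎
    where open ≤-Reasoning

  chosen≤U : ∀ X → chosen X ≤ U ⟦ X ⟧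
  chosen≤U X = *-cancelˡ-≤ (suc M) (begin
    suc M * chosen X                              ≤⟨ chosen-bound X ⟩
    sum (λ j → 𝟙 (lookup X j) * s j * occ j)      ≤⟨ sum-mono pointwise ⟩
    sum (λ j → suc M * (𝟙 (lookup X j) * U j))    ≡⟨ *-distribˡ-sum (suc M) (λ j → 𝟙 (lookup X j) * U j) ⟨
    suc M * U ⟦ X ⟧                               ∎)
    where
    open ≤-Reasoning
    swap : ∀ a b c → a * (b * c) ≡ b * (a * c)
    swap = solve-∀
    pointwise : ∀ j → 𝟙 (lookup X j) * s j * occ j ≤ suc M * (𝟙 (lookup X j) * U j)
    pointwise j = begin
      𝟙 (lookup X j) * s j * occ j       ≡⟨ *-assoc (𝟙 (lookup X j)) (s j) (occ j) ⟩
      𝟙 (lookup X j) * (s j * occ j)     ≤⟨ *-monoʳ-≤ (𝟙 (lookup X j)) (below-bound M (s j) (bound j)) ⟩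
      𝟙 (lookup X j) * (suc M * U j)     ≡⟨ swap (𝟙 (lookup X j)) (suc M) (U j) ⟩
      suc M * (𝟙 (lookup X j) * U j)     ∎

  -- Each class outside `X` pays for its own lower bound by `excess-bound`; what is left of the
  -- total weight `suc M * k` bounds the rows forced into `X`.
  chosen≤L : ∀ X → chosen X ≤ (k ∸ total) + L ⟦ X ⟧
  chosen≤L X = subst (chosen X ≤_) (+-∸-comm (L ⟦ X ⟧) total≤k) (m+n≤o⇒m≤o∸n (chosen X) (*-cancelˡ-≤ (suc M) (begin
    suc M * (chosen X + total)
      ≡⟨ *-distribˡ-+ (suc M) (chosen X) total ⟩
    suc M * chosen X + suc M * total
      ≤⟨ +-mono-≤ (chosen-bound X) (≤-reflexive (*-distribˡ-sum (suc M) L)) ⟩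
    sum (λ j → 𝟙 (lookup X j) * s j * occ j) + sum (λ j → suc M * L j)
      ≡⟨ ∑-distrib-+ (λ j → 𝟙 (lookup X j) * s j * occ j) (λ j → suc M * L j) ⟨
    sum (λ j → 𝟙 (lookup X j) * s j * occ j + suc M * L j)
      ≤⟨ sum-mono pointwise ⟩
    sum (λ j → s j * occ j + suc M * (𝟙 (lookup X j) * L j))
      ≡⟨ ∑-distrib-+ (λ j → s j * occ j) (λ j → suc M * (𝟙 (lookup X j) * L j)) ⟩
    sum (λ j → s j * occ j) + sum (λ j → suc M * (𝟙 (lookup X j) * L j))
      ≡⟨ cong₂ _+_ weight (*-distribˡ-sum (suc M) (λ j → 𝟙 (lookup X j) * L j)) ⟨
    suc M * k + suc M * L ⟦ X ⟧
      ≡⟨ *-distribˡ-+ (suc M) k (L ⟦ X ⟧) ⟨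
    suc M * (k + L ⟦ X ⟧) ∎)))
    where
    open ≤-Reasoning
    pointwise : ∀ j → 𝟙 (lookup X j) * s j * occ j + suc M * L j ≤ s j * occ j + suc M * (𝟙 (lookup X j) * L j)
    pointwise j with lookup X j
    ... | true  = ≤-reflexive (cong₂ (λ x y → x * occ j + suc M * y) (*-identityˡ (s j)) (sym (*-identityˡ (L j))))
    ... | false = ≤-trans (excess-bound M (s j) (bound j)) (m≤m+n _ _)

  open Rado c c-submodular c⊥≡0

  abstract
    selection : Σ (Fin k → Fin m) λ p → (∀ r → p r ∈ choices r) × (∀ X → sum (λ r → 𝟙 (lookup X (p r))) ≤ c X)
    selection = rado choices (λ _ → 0) (λ _ _ → z≤n) (λ X → ⊓-glb (chosen≤U X) (chosen≤L X))

  choice⇒part : ∀ {r j} → j ∈ choices r → Σ (Fin l) λ c → 1 ≤ s (cls r c) × j ≡ cls r c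
  choice⇒part {r} i with ∈-map⁻ (cls r) i
  ... | c , i′ , eq = c , proj₂ (∈-filter⁻ (λ c → 1 ≤? s (cls r c)) {xs = allFin l} i′) , eq

  pick-with-class : ∀ r → Σ (Fin l) λ c → 1 ≤ s (cls r c) × proj₁ selection r ≡ cls r c
  pick-with-class r = choice⇒part (proj₁ (proj₂ selection) r)

  pick : Fin k → Fin l
  pick r = proj₁ (pick-with-class r)

  pick-positive : ∀ r → 1 ≤ s (cls r (pick r))
  pick-positive r = proj₁ (proj₂ (pick-with-class r))

  picks : Fin m → ℕ
  picks j = sum (λ r → δ (cls r (pick r)) j)

  selected : ∀ X → sum (λ r → 𝟙 (lookup X (cls r (pick r)))) ≤ c X
  selected X = subst (_≤ c X) (sum-cong-≗ λ r → cong (λ j → 𝟙 (lookup X j)) (proj₂ (proj₂ (pick-with-class r))))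
                 (proj₂ (proj₂ selection) X)

  picks≤U : ∀ j → picks j ≤ U j
  picks≤U j = begin
    picks j                                      ≡⟨ sum-cong-≗ (λ r → cong 𝟙 (sym (lookup∘tabulate _ (cls r (pick r))))) ⟩
    sum (λ r → 𝟙 (lookup X (cls r (pick r))))    ≤⟨ selected X ⟩
    c X                                          ≤⟨ m⊓n≤m (U ⟦ X ⟧) _ ⟩
    U ⟦ X ⟧
      ≡⟨ sum-cong-≗ (λ i → cong (_* U i) (trans (cong 𝟙 (lookup∘tabulate _ i)) (δ-sym i j))) ⟩
    sum (λ i → δ j i * U i)                      ≡⟨ sum-δ j U ⟩
    U j                                          ∎
    where
    open ≤-Reasoning
    X : Subset m
    X = tabulate (λ i → ⌊ i Fin.≟ j ⌋)

  -- Apply the second bound to the complement of `j`: at most `k` - `L j` rows choose elsewhere.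
  L≤picks : ∀ j → L j ≤ picks j
  L≤picks j = +-cancelʳ-≤ k (L j) (picks j) (begin
    L j + k                                        ≡⟨ cong (L j +_) split-rows ⟩
    L j + (picks j + rest)
      ≤⟨ +-monoʳ-≤ (L j) (+-monoʳ-≤ (picks j) (≤-trans (selected X) (m⊓n≤n (U ⟦ X ⟧) _))) ⟩
    L j + (picks j + ((k ∸ total) + L ⟦ X ⟧))      ≡⟨ swap (L j) (picks j) (k ∸ total) (L ⟦ X ⟧) ⟩
    picks j + ((k ∸ total) + (L j + L ⟦ X ⟧))      ≡⟨ cong (λ z → picks j + ((k ∸ total) + z)) split-total ⟨
    picks j + ((k ∸ total) + total)                ≡⟨ cong (picks j +_) (m∸n+n≡m total≤k) ⟩
    picks j + k                                    ∎)
    where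
    open ≤-Reasoning
    X : Subset m
    X = tabulate (λ i → not ⌊ i Fin.≟ j ⌋)
    rest : ℕ
    rest = sum (λ r → 𝟙 (lookup X (cls r (pick r))))
    swap : ∀ a b c d → a + (b + (c + d)) ≡ b + (c + (a + d))
    swap = solve-∀
    partition : ∀ i → δ i j + 𝟙 (lookup X i) ≡ 1
    partition i = trans (cong (λ b → δ i j + 𝟙 b) (lookup∘tabulate _ i)) (𝟙-not ⌊ i Fin.≟ j ⌋)
    split-rows : k ≡ picks j + rest
    split-rows = sym (trans (sym (∑-distrib-+ (λ r → δ (cls r (pick r)) j) (λ r → 𝟙 (lookup X (cls r (pick r))))))
      (trans (sum-cong-≗ λ r → partition (cls r (pick r))) (trans (sum-const k 1) (*-identityʳ k))))
    split-total : total ≡ L j + L ⟦ X ⟧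
    split-total = sym (trans (cong (_+ L ⟦ X ⟧) (trans (sym (sum-δ j L)) (sum-cong-≗ λ i → cong (_* L i) (δ-sym j i))))
      (trans (sym (∑-distrib-+ (λ i → δ i j * L i) (λ i → 𝟙 (lookup X i) * L i)))
        (sum-cong-≗ λ i → trans (sym (*-distribʳ-+ (L i) (δ i j) (𝟙 (lookup X i))))
          (trans (cong (_* L i) (partition i)) (*-identityˡ (L i))))))

  -- Every class splits in two: the left copy is for the parts without the new element, the right
  -- copy for those that took it.
  s′ : Fin (m + m) → ℕ
  s′ = [ s , pred ∘ s ]′ ∘ splitAt m

  cls′ : Fin k → Fin l → Fin (m + m)
  cls′ r c with pick r Fin.≟ c
  ... | yes _ = m ↑ʳ cls r c
  ... | no  _ = cls r c ↑ˡ m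

  s-split : ∀ r c → δ (pick r) c + s′ (cls′ r c) ≡ s (cls r c)
  s-split r c with pick r Fin.≟ c
  ... | yes refl rewrite Fin.splitAt-↑ʳ m m (cls r c) = m+[n∸m]≡n (pick-positive r)
  ... | no  _    rewrite Fin.splitAt-↑ˡ m (cls r c) m = refl

  row′ : ∀ r → sum (λ c → s′ (cls′ r c)) ≡ M
  row′ r = suc-injective (begin
    1 + sum (λ c → s′ (cls′ r c))
      ≡⟨ cong (_+ sum (λ c → s′ (cls′ r c))) (trans (sym (sum-δ (pick r) (λ _ → 1))) (sum-cong-≗ λ c → *-identityʳ (δ (pick r) c))) ⟩
    sum (λ c → δ (pick r) c) + sum (λ c → s′ (cls′ r c))
      ≡⟨ ∑-distrib-+ (λ c → δ (pick r) c) (λ c → s′ (cls′ r c)) ⟨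
    sum (λ c → δ (pick r) c + s′ (cls′ r c))
      ≡⟨ sum-cong-≗ (s-split r) ⟩
    sum (λ c → s (cls r c))
      ≡⟨ row r ⟩
    suc M ∎)
    where open ≡-Reasoning

  δ-↑ˡ : ∀ (i j : Fin m) → δ (i ↑ˡ m) (j ↑ˡ m) ≡ δ i j
  δ-↑ˡ i j with i Fin.≟ j
  ... | yes refl = δ-refl (i ↑ˡ m)
  ... | no  i≢j  = δ-≢ (i≢j ∘ Fin.↑ˡ-injective m i j)

  δ-↑ʳ : ∀ (i j : Fin m) → δ (m ↑ʳ i) (m ↑ʳ j) ≡ δ i j
  δ-↑ʳ i j with i Fin.≟ j
  ... | yes refl = δ-refl (m ↑ʳ i)
  ... | no  i≢j  = δ-≢ (i≢j ∘ Fin.↑ʳ-injective m i j)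

  ↑ˡ≢↑ʳ : ∀ (i j : Fin m) → ¬ (i ↑ˡ m ≡ m ↑ʳ j)
  ↑ˡ≢↑ʳ i j eq with trans (sym (Fin.splitAt-↑ˡ m i m)) (trans (cong (splitAt m) eq) (Fin.splitAt-↑ʳ m m j))
  ... | ()

  joined : ∀ (j : Fin m) r c → δ (cls′ r c) (m ↑ʳ j) ≡ δ (pick r) c * δ (cls r c) j
  joined j r c with pick r Fin.≟ c
  ... | yes _ = trans (δ-↑ʳ (cls r c) j) (sym (*-identityˡ _))
  ... | no  _ = δ-≢ (↑ˡ≢↑ʳ (cls r c) j)

  stayed : ∀ (j : Fin m) r c → δ (cls′ r c) (j ↑ˡ m) + δ (pick r) c * δ (cls r c) j ≡ δ (cls r c) j
  stayed j r c with pick r Fin.≟ c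
  ... | yes _ = cong₂ _+_ (δ-≢ (↑ˡ≢↑ʳ j (cls r c) ∘ sym)) (*-identityˡ _)
  ... | no  _ = trans (+-identityʳ _) (δ-↑ˡ (cls r c) j)

  joined-count : ∀ j → occurrences cls′ (m ↑ʳ j) ≡ picks j
  joined-count j = sum-cong-≗ λ r → trans (sum-cong-≗ (joined j r)) (sum-δ (pick r) (λ c → δ (cls r c) j))

  stayed-count : ∀ j → occurrences cls′ (j ↑ˡ m) + picks j ≡ occ j
  stayed-count j = begin
    occurrences cls′ (j ↑ˡ m) + picks j
      ≡⟨ ∑-distrib-+ (λ r → sum λ c → δ (cls′ r c) (j ↑ˡ m)) (λ r → δ (cls r (pick r)) j) ⟨
    sum (λ r → sum (λ c → δ (cls′ r c) (j ↑ˡ m)) + δ (cls r (pick r)) j)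
      ≡⟨ sum-cong-≗ (λ r → trans (cong (sum (λ c → δ (cls′ r c) (j ↑ˡ m)) +_) (sym (sum-δ (pick r) (λ c → δ (cls r c) j))))
           (trans (sym (∑-distrib-+ (λ c → δ (cls′ r c) (j ↑ˡ m)) (λ c → δ (pick r) c * δ (cls r c) j)))
             (sum-cong-≗ (stayed j r)))) ⟩
    occ j ∎
    where open ≡-Reasoning

  -- Left copies need the lower bound on the picks, right copies the upper bound.
  bound′ : ∀ j → occurrences cls′ j ≤ M C s′ j
  bound′ j with splitAt m j in eq
  ... | inj₁ i rewrite sym (Fin.splitAt⁻¹-↑ˡ eq) = +-cancelʳ-≤ (picks i) _ _ (begin
    occurrences cls′ (i ↑ˡ m) + picks i  ≡⟨ stayed-count i ⟩
    occ i                                ≤⟨ m≤n+m∸n (occ i) (M C s i) ⟩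
    M C s i + L i                        ≤⟨ +-monoʳ-≤ (M C s i) (L≤picks i) ⟩
    M C s i + picks i                    ∎)
    where open ≤-Reasoning
  ... | inj₂ i rewrite sym (Fin.splitAt⁻¹-↑ʳ eq) | joined-count i with s i | picks≤U i
  ...   | zero  | p = ≤-trans p z≤n
  ...   | suc t | p = p

-- Induction on the number of elements still to come. Parts of one class that take the same elements
-- end in the same final class, which has room for only one part.
baranyai : ∀ M (s : Fin m → ℕ) (cls : Fin k → Fin l → Fin m) →
  (∀ r → sum (λ c → s (cls r c)) ≡ M) → (∀ j → occurrences cls j ≤ M C s j) →
  Σ (Fin M → Fin k → Fin l) λ A →
    (∀ r c → sum (λ x → δ (A x r) c) ≡ s (cls r c)) ×
    (∀ r c r′ c′ → cls r c ≡ cls r′ c′ → (∀ x → δ (A x r) c ≡ δ (A x r′) c′) → r ≡ r′ × c ≡ c′)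
baranyai {k = k} zero s cls row bound = (λ ()) , (λ r c → sym (s≡0 r c)) , unique
  where
  s≡0 : ∀ r c → s (cls r c) ≡ 0
  s≡0 r c = n≤0⇒n≡0 (≤-trans (term≤sum (λ c → s (cls r c)) c) (≤-reflexive (row r)))
  unique : ∀ r c r′ c′ → cls r c ≡ cls r′ c′ → _ → r ≡ r′ × c ≡ c′
  unique r c r′ c′ eq _ = go r≡r′ at-r′
    where
    j = cls r c
    row-occ : Fin k → ℕ
    row-occ r = sum λ c → δ (cls r c) j
    le : occurrences cls j ≤ 1
    le = subst (λ z → occurrences cls j ≤ 0 C z) (s≡0 r c) (bound j)
    at-r : 1 ≤ δ (cls r c) j
    at-r = ≤-reflexive (sym (δ-refl j))
    at-r′ : 1 ≤ δ (cls r′ c′) j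
    at-r′ = ≤-reflexive (sym (trans (cong (λ z → δ z j) (sym eq)) (δ-refl j)))
    r≡r′ : r ≡ r′
    r≡r′ = sum≤1⇒unique row-occ le r r′ (≤-trans at-r (term≤sum (λ c → δ (cls r c) j) c))
                                        (≤-trans at-r′ (term≤sum (λ c → δ (cls r′ c) j) c′))
    go : r ≡ r′ → 1 ≤ δ (cls r′ c′) j → r ≡ r′ × c ≡ c′
    go refl at = refl , sum≤1⇒unique (λ c → δ (cls r c) j) (≤-trans (term≤sum row-occ r) le) c c′ at-r at
baranyai {m} {k} {l} (suc M) s cls row bound with baranyai M s′ cls′ row′ bound′
  where open Step M s cls row bound
... | A , sizes , distinct = A′ , sizes′ , distinct′
  where
  open Step M s cls row bound
  A′ : Fin (suc M) → Fin k → Fin l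
  A′ zero    = pick
  A′ (suc x) = A x
  sizes′ : ∀ r c → sum (λ x → δ (A′ x r) c) ≡ s (cls r c)
  sizes′ r c = trans (cong (δ (pick r) c +_) (sizes r c)) (s-split r c)
  distinct′ : ∀ r c r′ c′ → cls r c ≡ cls r′ c′ → (∀ x → δ (A′ x r) c ≡ δ (A′ x r′) c′) → r ≡ r′ × c ≡ c′
  distinct′ r c r′ c′ eq same = distinct r c r′ c′ (same-class (same zero)) (same ∘ suc)
    where
    same-class : δ (pick r) c ≡ δ (pick r′) c′ → cls′ r c ≡ cls′ r′ c′
    same-class h with pick r Fin.≟ c | pick r′ Fin.≟ c′
    ... | yes _ | yes _ = cong (m ↑ʳ_) eq
    ... | no  _ | no  _ = cong (_↑ˡ m) eq

-- From prescribed part sizes to locating arrays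

δℕ : ℕ → ℕ → ℕ
δℕ i j = 𝟙 ⌊ i ≟ j ⌋

δℕ-refl : ∀ i → δℕ i i ≡ 1
δℕ-refl i with i ≟ i
... | yes _ = refl
... | no ¬p = contradiction refl ¬p

δℕ-≢ : ∀ {i j} → ¬ (i ≡ j) → δℕ i j ≡ 0
δℕ-≢ {i} {j} i≢j with i ≟ j
... | yes i≡j = contradiction i≡j i≢j
... | no  _   = refl

-- Differs from C(n, i) only at i = 0: the empty set is not an admissible part.
nonempty : ℕ → ℕ → ℕ
nonempty n zero    = 0
nonempty n (suc i) = n C suc i

nonempty≤C : ∀ n i → nonempty n i ≤ n C i
nonempty≤C n zero    = z≤n
nonempty≤C n (suc i) = ≤-refl

module _ {N : ℕ} (A : Array N k l) where

  part-size : Fin k → Fin l → ℕ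
  part-size γ σ = sum (λ x → δ (A x γ) σ)

  same-part⇒δ : ∀ {γ σ γ′ σ′} → ρ A (just (γ , σ)) ≡ ρ A (just (γ′ , σ′)) → ∀ x → δ (A x γ) σ ≡ δ (A x γ′) σ′
  same-part⇒δ {γ} {σ} {γ′} {σ′} eq x = cong 𝟙 (trans (sym (lookup∘tabulate _ x))
    (trans (cong (λ S → lookup S x) eq) (lookup∘tabulate _ x)))

  empty-part⇒size≡0 : ∀ {γ σ} → ρ A (just (γ , σ)) ≡ ⊥ → part-size γ σ ≡ 0
  empty-part⇒size≡0 {γ} {σ} eq = trans (sum-cong-≗ λ x → cong 𝟙 (trans (sym (lookup∘tabulate _ x))
    (trans (cong (λ S → lookup S x) eq) (lookup-replicate x false)))) (trans (sum-const N 0) (*-zeroʳ N))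

  locating : (∀ γ σ → 1 ≤ part-size γ σ) →
    (∀ γ σ γ′ σ′ → (∀ x → δ (A x γ) σ ≡ δ (A x γ′) σ′) → γ ≡ γ′ × σ ≡ σ′) → IsLocating A
  locating pos distinct T₁ T₂ = mk⇔ (to T₁ T₂) (cong (ρ A))
    where
    absurd : ∀ {γ σ} {B : Set} → ρ A (just (γ , σ)) ≡ ⊥ → B
    absurd eq = contradiction (≤-trans (pos _ _) (≤-reflexive (empty-part⇒size≡0 eq))) λ ()
    to : ∀ T₁ T₂ → ρ A T₁ ≡ ρ A T₂ → T₁ ≡ T₂
    to nothing        nothing          eq = refl
    to nothing        (just (γ , σ))   eq = absurd (sym eq)
    to (just (γ , σ)) nothing          eq = absurd eq
    to (just (γ , σ)) (just (γ′ , σ′)) eq with distinct γ σ γ′ σ′ (same-part⇒δ eq)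
    ... | refl , refl = refl

realise : ∀ N (size : Fin k → Fin l → ℕ) → (∀ r → sum (size r) ≡ N) →
  (∀ i → sum (λ r → sum λ c → δℕ (size r c) i) ≤ nonempty N i) →
  Σ (Array N k l) IsLocating
realise {k} {l} N size row bound with baranyai N toℕ cls row′ bound′
  where
  size<sucN : ∀ r c → size r c < suc N
  size<sucN r c = s≤s (≤-trans (term≤sum (size r) c) (≤-reflexive (row r)))
  -- The initial class of a part is its size, so parts of different classes are distinct anyway.
  cls : Fin k → Fin l → Fin (suc N)
  cls r c = fromℕ< (size<sucN r c)
  row′ : ∀ r → sum (λ c → toℕ (cls r c)) ≡ N
  row′ r = trans (sum-cong-≗ λ c → Fin.toℕ-fromℕ< (size<sucN r c)) (row r)
  δ≡δℕ : ∀ r c j → δ (cls r c) j ≡ δℕ (size r c) (toℕ j)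
  δ≡δℕ r c j with size r c ≟ toℕ j
  ... | yes eq = trans (cong (λ i → δ i j) (Fin.toℕ-injective (trans (Fin.toℕ-fromℕ< _) eq))) (δ-refl j)
  ... | no neq = δ-≢ λ eq → neq (trans (sym (Fin.toℕ-fromℕ< _)) (cong toℕ eq))
  bound′ : ∀ j → occurrences cls j ≤ N C toℕ j
  bound′ j = ≤-trans (≤-reflexive (sum-cong-≗ λ r → sum-cong-≗ λ c → δ≡δℕ r c j))
               (≤-trans (bound (toℕ j)) (nonempty≤C N (toℕ j)))
... | A , sizes , distinct = A , locating A pos λ γ σ γ′ σ′ same → distinct γ σ γ′ σ′ (same-class same) same
  where
  size-A : ∀ γ σ → part-size A γ σ ≡ size γ σ
  size-A γ σ = trans (sizes γ σ) (Fin.toℕ-fromℕ< _)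
  same-class : ∀ {γ σ γ′ σ′} → (∀ x → δ (A x γ) σ ≡ δ (A x γ′) σ′) → _ ≡ _
  same-class {γ} {σ} {γ′} {σ′} same = Fin.toℕ-injective (trans (sym (sizes γ σ)) (trans (sum-cong-≗ same) (sizes γ′ σ′)))
  pos : ∀ γ σ → 1 ≤ part-size A γ σ
  pos γ σ rewrite size-A γ σ = n≢0⇒n>0 λ size≡0 → contradiction
    (begin
      1                                        ≡⟨ δℕ-refl 0 ⟨
      δℕ 0 0                                   ≡⟨ cong (λ z → δℕ z 0) size≡0 ⟨
      δℕ (size γ σ) 0                          ≤⟨ term≤sum (λ c → δℕ (size γ c) 0) σ ⟩
      sum (λ c → δℕ (size γ c) 0)              ≤⟨ term≤sum (λ r → sum λ c → δℕ (size r c) 0) γ ⟩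
      sum (λ r → sum λ c → δℕ (size r c) 0)    ≤⟨ bound 0 ⟩
      0                                        ∎) λ ()
    where open ≤-Reasoning

-- Sums over all subsets and the upper bound

Σ< : ℕ → (ℕ → ℕ) → ℕ
Σ< zero    h = 0
Σ< (suc n) h = Σ< n h + h n

Σ<-cong : ∀ n {g h} → (∀ i → i < n → g i ≡ h i) → Σ< n g ≡ Σ< n h
Σ<-cong zero    eq = refl
Σ<-cong (suc n) eq = cong₂ _+_ (Σ<-cong n λ i i<n → eq i (m<n⇒m<1+n i<n)) (eq n ≤-refl)

Σ<-mono : ∀ n {g h} → (∀ i → i < n → g i ≤ h i) → Σ< n g ≤ Σ< n h
Σ<-mono zero    le = z≤n
Σ<-mono (suc n) le = +-mono-≤ (Σ<-mono n λ i i<n → le i (m<n⇒m<1+n i<n)) (le n ≤-refl)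

Σ<-+ : ∀ n g h → Σ< n (λ i → g i + h i) ≡ Σ< n g + Σ< n h
Σ<-+ zero    g h = refl
Σ<-+ (suc n) g h = trans (cong (_+ (g n + h n)) (Σ<-+ n g h)) (swap (Σ< n g) (Σ< n h) (g n) (h n))
  where
  swap : ∀ a b c d → (a + b) + (c + d) ≡ (a + c) + (b + d)
  swap = solve-∀

Σ<-* : ∀ n x h → Σ< n (λ i → x * h i) ≡ x * Σ< n h
Σ<-* zero    x h = sym (*-zeroʳ x)
Σ<-* (suc n) x h = trans (cong (_+ x * h n) (Σ<-* n x h)) (sym (*-distribˡ-+ x (Σ< n h) (h n)))

Σ<-front : ∀ n h → Σ< (suc n) h ≡ h 0 + Σ< n (h ∘ suc)
Σ<-front zero    h = +-comm 0 (h 0)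
Σ<-front (suc n) h = trans (cong (_+ h (suc n)) (Σ<-front n h)) (+-assoc (h 0) (Σ< n (h ∘ suc)) (h (suc n)))

ΣS : (Subset n → ℕ) → ℕ
ΣS {zero}  G = G []
ΣS {suc n} G = ΣS (λ S → G (false ∷ S)) + ΣS (λ S → G (true ∷ S))

ΣS-cong : {G H : Subset n → ℕ} → (∀ S → G S ≡ H S) → ΣS G ≡ ΣS H
ΣS-cong {zero}  eq = eq []
ΣS-cong {suc n} eq = cong₂ _+_ (ΣS-cong λ S → eq (false ∷ S)) (ΣS-cong λ S → eq (true ∷ S))

ΣS-mono : {G H : Subset n → ℕ} → (∀ S → G S ≤ H S) → ΣS G ≤ ΣS H
ΣS-mono {zero}  le = le []
ΣS-mono {suc n} le = +-mono-≤ (ΣS-mono λ S → le (false ∷ S)) (ΣS-mono λ S → le (true ∷ S))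

ΣS-zero : ∀ n → ΣS {n} (λ _ → 0) ≡ 0
ΣS-zero zero    = refl
ΣS-zero (suc n) = cong₂ _+_ (ΣS-zero n) (ΣS-zero n)

ΣS-sum : (h : Fin m → Subset n → ℕ) → ΣS (λ S → sum λ r → h r S) ≡ sum (λ r → ΣS (h r))
ΣS-sum {n = zero}  h = refl
ΣS-sum {n = suc n} h = trans (cong₂ _+_ (ΣS-sum (λ r S → h r (false ∷ S))) (ΣS-sum (λ r S → h r (true ∷ S))))
  (sym (∑-distrib-+ (λ r → ΣS (λ S → h r (false ∷ S))) (λ r → ΣS (λ S → h r (true ∷ S)))))

same : Subset n → Subset n → ℕ
same []           []           = 1
same (true  ∷ S)  (true  ∷ T)  = same S T
same (false ∷ S)  (false ∷ T)  = same S T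
same (true  ∷ S)  (false ∷ T)  = 0
same (false ∷ S)  (true  ∷ T)  = 0

same⇒≡ : (S T : Subset n) → 1 ≤ same S T → S ≡ T
same⇒≡ []           []           _ = refl
same⇒≡ (true  ∷ S)  (true  ∷ T)  p = cong (true ∷_) (same⇒≡ S T p)
same⇒≡ (false ∷ S)  (false ∷ T)  p = cong (false ∷_) (same⇒≡ S T p)

same≤1 : (S T : Subset n) → same S T ≤ 1
same≤1 []           []           = ≤-refl
same≤1 (true  ∷ S)  (true  ∷ T)  = same≤1 S T
same≤1 (false ∷ S)  (false ∷ T)  = same≤1 S T
same≤1 (true  ∷ S)  (false ∷ T)  = z≤n
same≤1 (false ∷ S)  (true  ∷ T)  = z≤n

ΣS-same : (T : Subset n) (G : Subset n → ℕ) → ΣS (λ S → same S T * G S) ≡ G T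
ΣS-same []          G = +-identityʳ (G [])
ΣS-same {suc n} (true  ∷ T) G = trans (cong (_+ ΣS (λ S → same S T * G (true ∷ S))) (ΣS-zero n))
                                      (ΣS-same T (λ S → G (true ∷ S)))
ΣS-same {suc n} (false ∷ T) G = trans (cong (ΣS (λ S → same S T * G (false ∷ S)) +_) (ΣS-zero n))
                                      (trans (+-identityʳ _) (ΣS-same T (λ S → G (false ∷ S))))

sum-positive : (h : Fin n → ℕ) → 1 ≤ sum h → Σ (Fin n) λ i → 1 ≤ h i
sum-positive {suc n} h p with 1 ≤? h zero
... | yes q = zero , q
... | no ¬q with sum-positive (h ∘ suc) (subst (λ z → 1 ≤ z + sum (h ∘ suc)) (n≤0⇒n≡0 (s≤s⁻¹ (≰⇒> ¬q))) p)
...   | i , q = suc i , q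

unique⇒sum≤1 : (h : Fin n → ℕ) → (∀ i → h i ≤ 1) → (∀ i j → 1 ≤ h i → 1 ≤ h j → i ≡ j) → sum h ≤ 1
unique⇒sum≤1 {zero}  h le unique = z≤n
unique⇒sum≤1 {suc n} h le unique with 1 ≤? sum (h ∘ suc)
... | no ¬q = ≤-trans (+-mono-≤ (le zero) (s≤s⁻¹ (≰⇒> ¬q))) ≤-refl
... | yes q with sum-positive (h ∘ suc) q
...   | i , hi rewrite n≤0⇒n≡0 {h zero} (s≤s⁻¹ (≰⇒> λ h0 → contradiction (unique zero (suc i) h0 hi) λ ()))
  = unique⇒sum≤1 (h ∘ suc) (le ∘ suc) (λ i j p q → Fin.suc-injective (unique (suc i) (suc j) p q))

distinct-subsets-sum : (P : Fin k → Fin l → Subset n) →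
  (∀ r c r′ c′ → P r c ≡ P r′ c′ → r ≡ r′ × c ≡ c′) → (G : Subset n → ℕ) →
  sum (λ r → sum λ c → G (P r c)) ≤ ΣS G
distinct-subsets-sum {k} {l} {n} P distinct G = begin
  sum (λ r → sum λ c → G (P r c))
    ≡⟨ sum-cong-≗ (λ r → sum-cong-≗ λ c → sym (ΣS-same (P r c) G)) ⟩
  sum (λ r → sum λ c → ΣS λ S → same S (P r c) * G S)
    ≡⟨ sum-cong-≗ (λ r → sym (ΣS-sum λ c S → same S (P r c) * G S)) ⟩
  sum (λ r → ΣS λ S → sum λ c → same S (P r c) * G S)
    ≡⟨ ΣS-sum (λ r S → sum λ c → same S (P r c) * G S) ⟨
  ΣS (λ S → sum λ r → sum λ c → same S (P r c) * G S)
    ≡⟨ ΣS-cong (λ S → sym (trans (*-distribʳ-sum (G S) (λ r → sum λ c → same S (P r c)))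
                            (sum-cong-≗ λ r → *-distribʳ-sum (G S) (λ c → same S (P r c))))) ⟩
  ΣS (λ S → sum (λ r → sum λ c → same S (P r c)) * G S)
    ≤⟨ ΣS-mono (λ S → *-monoˡ-≤ (G S) (once S)) ⟩
  ΣS (λ S → 1 * G S)
    ≡⟨ ΣS-cong (λ S → *-identityˡ (G S)) ⟩
  ΣS G ∎
  where
  open ≤-Reasoning
  once : ∀ S → sum (λ r → sum λ c → same S (P r c)) ≤ 1
  once S = unique⇒sum≤1 _
    (λ r → unique⇒sum≤1 _ (λ c → same≤1 S (P r c)) (λ c c′ p q → proj₂ (hit r c r c′ p q)))
    (λ r r′ p q → let c , p′ = sum-positive _ p; c′ , q′ = sum-positive _ q in proj₁ (hit r c r′ c′ p′ q′))
    where
    hit : ∀ r c r′ c′ → 1 ≤ same S (P r c) → 1 ≤ same S (P r′ c′) → r ≡ r′ × c ≡ c′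
    hit r c r′ c′ p q = distinct r c r′ c′ (trans (sym (same⇒≡ S _ p)) (same⇒≡ S _ q))

-- Splitting on the first element amounts to Pascal's rule. The cut-off `K` is independent of `n`,
-- so that it can drop by one together with the shift to `h ∘ suc`.
ΣS-by-size : ∀ n K (h : ℕ → ℕ) → (∀ i → K ≤ i → h i ≡ 0) → ΣS {n} (λ S → h ∣ S ∣) ≡ Σ< K (λ i → h i * (n C i))
ΣS-by-size zero zero h vanish = vanish 0 z≤n
ΣS-by-size zero (suc K) h vanish = sym (trans (Σ<-front K _) (trans (cong₂ _+_ (*-identityʳ (h 0))
  (trans (Σ<-cong K (λ i _ → trans (cong (h (suc i) *_) (k>n⇒nCk≡0 {0} {suc i} (s≤s z≤n))) (*-comm (h (suc i)) 0)))
         (Σ<-* K 0 (λ _ → 0)))) (+-identityʳ (h 0))))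
ΣS-by-size (suc n) zero h vanish =
  cong₂ _+_ (ΣS-by-size n zero h vanish) (ΣS-by-size n zero (h ∘ suc) (λ i _ → vanish (suc i) z≤n))
ΣS-by-size (suc n) (suc K) h vanish = begin
  ΣS {n} (λ S → h ∣ S ∣) + ΣS {n} (λ S → h (suc ∣ S ∣))
    ≡⟨ cong₂ _+_ (ΣS-by-size n (suc K) h vanish) (ΣS-by-size n K (h ∘ suc) (λ i K≤i → vanish (suc i) (s≤s K≤i))) ⟩
  Σ< (suc K) (λ i → h i * (n C i)) + Σ< K (λ i → h (suc i) * (n C i))
    ≡⟨ cong (_+ Σ< K (λ i → h (suc i) * (n C i))) (Σ<-front K (λ i → h i * (n C i))) ⟩
  h 0 * (n C 0) + Σ< K (λ i → h (suc i) * (n C suc i)) + Σ< K (λ i → h (suc i) * (n C i))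
    ≡⟨ trans (+-assoc (h 0 * (n C 0)) _ _) (cong₂ (λ x y → h 0 * x + y) (trans (nC0≡1 n) (sym (nC0≡1 (suc n))))
         (sym (Σ<-+ K (λ i → h (suc i) * (n C suc i)) (λ i → h (suc i) * (n C i))))) ⟩
  h 0 * (suc n C 0) + Σ< K (λ i → h (suc i) * (n C suc i) + h (suc i) * (n C i))
    ≡⟨ cong (h 0 * (suc n C 0) +_) (Σ<-cong K λ i _ → trans (sym (*-distribˡ-+ (h (suc i)) (n C suc i) (n C i)))
         (cong (h (suc i) *_) (trans (+-comm (n C suc i) (n C i)) (nCk+nC[k+1]≡[n+1]C[k+1] n i)))) ⟩
  h 0 * (suc n C 0) + Σ< K (λ i → h (suc i) * (suc n C suc i))
    ≡⟨ Σ<-front K (λ i → h i * (suc n C i)) ⟨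
  Σ< (suc K) (λ i → h i * (suc n C i)) ∎
  where open ≡-Reasoning

∣tabulate∣ : (p : Fin n → Bool) → ∣ tabulate p ∣ ≡ sum (λ i → 𝟙 (p i))
∣tabulate∣ {zero}  p = refl
∣tabulate∣ {suc n} p with p zero
... | true  = cong suc (∣tabulate∣ (p ∘ suc))
... | false = ∣tabulate∣ (p ∘ suc)

⊓-sum : ∀ d (w : Fin n → ℕ) → d ⊓ sum w ≤ sum (λ i → d ⊓ w i)
⊓-sum {zero}  d w = m⊓n≤n d 0
⊓-sum {suc n} d w = ≤-trans (⊓-subadditive (w zero) (sum (w ∘ suc))) (+-monoʳ-≤ (d ⊓ w zero) (⊓-sum d (w ∘ suc)))
  where
  ⊓-subadditive : ∀ a b → d ⊓ (a + b) ≤ d ⊓ a + d ⊓ b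
  ⊓-subadditive a b with ≤-total d a | ≤-total d b
  ... | inj₁ d≤a | _ rewrite m≤n⇒m⊓n≡m d≤a = ≤-trans (m⊓n≤m d _) (m≤m+n d _)
  ... | inj₂ a≤d | inj₁ d≤b rewrite m≤n⇒m⊓n≡m d≤b = ≤-trans (m⊓n≤m d _) (m≤n+m d _)
  ... | inj₂ a≤d | inj₂ b≤d rewrite m≥n⇒m⊓n≡n a≤d | m≥n⇒m⊓n≡n b≤d = m⊓n≤n d _

-- A part of size t < F is charged d ⊓ (F ∸ t); every column pays at least d, and a subset is charged only once.
upper-bound : ∀ {N} F d → F * l ≡ N + d → (A : Array N k l) → IsLocating A →
  k * d ≤ Σ< F (λ i → (d ⊓ (F ∸ i)) * nonempty N i)
upper-bound {l} {k} {N} F d Fv A loc = begin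
  k * d                                        ≡⟨ sum-const k d ⟨
  sum {k} (λ _ → d)                            ≤⟨ sum-mono column ⟩
  sum (λ γ → sum λ σ → charge (part-size A γ σ))
    ≡⟨ sum-cong-≗ (λ γ → sum-cong-≗ λ σ → charge≡ γ σ) ⟩
  sum (λ γ → sum λ σ → charge⁺ ∣ P γ σ ∣)      ≤⟨ distinct-subsets-sum P distinct (λ S → charge⁺ ∣ S ∣) ⟩
  ΣS {N} (λ S → charge⁺ ∣ S ∣)                 ≡⟨ ΣS-by-size N F charge⁺ vanish ⟩
  Σ< F (λ i → charge⁺ i * (N C i))               ≡⟨ Σ<-cong F (λ i _ → transfer i) ⟩
  Σ< F (λ i → charge i * nonempty N i)         ∎
  where
  open ≤-Reasoning
  charge charge⁺ : ℕ → ℕ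
  charge t = d ⊓ (F ∸ t)
  charge⁺ zero    = 0
  charge⁺ (suc t) = charge (suc t)
  P : Fin k → Fin l → Subset N
  P γ σ = ρ A (just (γ , σ))
  distinct : ∀ γ σ γ′ σ′ → P γ σ ≡ P γ′ σ′ → γ ≡ γ′ × σ ≡ σ′
  distinct γ σ γ′ σ′ eq with Equivalence.to (loc (just (γ , σ)) (just (γ′ , σ′))) eq
  ... | refl = refl , refl
  size≡ : ∀ γ σ → ∣ P γ σ ∣ ≡ part-size A γ σ
  size≡ γ σ = ∣tabulate∣ (λ x → ⌊ A x γ Fin.≟ σ ⌋)
  charge≡ : ∀ γ σ → charge (part-size A γ σ) ≡ charge⁺ ∣ P γ σ ∣
  charge≡ γ σ rewrite sym (size≡ γ σ) with ∣ P γ σ ∣ in eq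
  ... | suc t = refl
  ... | zero  with Equivalence.to (loc (just (γ , σ)) nothing) (∣p∣≡0⇒p≡⊥ (P γ σ) eq)
    where
    ∣p∣≡0⇒p≡⊥ : ∀ {n} (p : Subset n) → ∣ p ∣ ≡ 0 → p ≡ ⊥
    ∣p∣≡0⇒p≡⊥ []          _ = refl
    ∣p∣≡0⇒p≡⊥ (false ∷ p) h = cong (false ∷_) (∣p∣≡0⇒p≡⊥ p h)
  ...   | ()
  vanish : ∀ i → F ≤ i → charge⁺ i ≡ 0
  vanish zero    _   = refl
  vanish (suc i) F≤i = trans (cong (d ⊓_) (m≤n⇒m∸n≡0 F≤i)) (⊓-zeroʳ d)
  transfer : ∀ i → charge⁺ i * (N C i) ≡ charge i * nonempty N i
  transfer zero    = sym (*-zeroʳ (charge 0))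
  transfer (suc i) = refl
  column-size : ∀ γ → sum (part-size A γ) ≡ N
  column-size γ = trans (∑-comm (λ σ x → δ (A x γ) σ)) (trans (sum-cong-≗ λ x →
    trans (sum-cong-≗ λ σ → sym (*-identityʳ (δ (A x γ) σ))) (sum-δ (A x γ) (λ _ → 1))) (trans (sum-const N 1) (*-identityʳ N)))
  column : ∀ γ → d ≤ sum (λ σ → charge (part-size A γ σ))
  column γ = ≤-trans (≤-reflexive (sym (m≤n⇒m⊓n≡m deficiency))) (⊓-sum d (λ σ → F ∸ part-size A γ σ))
    where
    -- Without truncation the sum is l F - N = d; parts larger than `F` can only raise it.
    deficiency : d ≤ sum (λ σ → F ∸ part-size A γ σ)
    deficiency = +-cancelˡ-≤ N d _ (begin
      N + d                                                            ≡⟨ trans (sym Fv) (*-comm F l) ⟩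
      l * F                                                            ≡⟨ sum-const l F ⟨
      sum {l} (λ _ → F)                                                ≤⟨ sum-mono (λ σ → m≤n+m∸n F (part-size A γ σ)) ⟩
      sum (λ σ → part-size A γ σ + (F ∸ part-size A γ σ))
        ≡⟨ ∑-distrib-+ (part-size A γ) (λ σ → F ∸ part-size A γ σ) ⟩
      sum (part-size A γ) + sum (λ σ → F ∸ part-size A γ σ)
        ≡⟨ cong (_+ sum (λ σ → F ∸ part-size A γ σ)) (column-size γ) ⟩
      N + sum (λ σ → F ∸ part-size A γ σ)                              ∎)

-- Inequalities between levels of the subset lattice

≤-from : ∀ {x y} z → y ≡ x + z → x ≤ y
≤-from z eq = ≤-trans (m≤m+n _ z) (≤-reflexive (sym eq))

C-succ : ∀ {N} j u → N ≡ j + u → suc j * (N C suc j) ≡ u * (N C j)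
C-succ {N} j u refl = +-cancelˡ-≡ (suc j * (N C j)) _ _ (begin
  suc j * (N C j) + suc j * (N C suc j)  ≡⟨ *-distribˡ-+ (suc j) (N C j) (N C suc j) ⟨
  suc j * (N C j + N C suc j)            ≡⟨ cong (suc j *_) (nCk+nC[k+1]≡[n+1]C[k+1] N j) ⟩
  suc j * (suc N C suc j)                ≡⟨ absorption N j ⟩
  (suc j + u) * (N C j)                  ≡⟨ *-distribʳ-+ (N C j) (suc j) u ⟩
  suc j * (N C j) + u * (N C j)          ∎)
  where open ≡-Reasoning

-- While i + j stays below the upper index, Pascal's rule reduces the claim to the previous row; on
-- the boundary both coefficients agree by symmetry.
C-unimodal : ∀ N {i j} → i ≤ j → i + j ≤ N → N C i ≤ N C j
C-unimodal N       {zero}  {zero}  _ _ = ≤-refl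
C-unimodal N       {suc i} {zero}  () _
C-unimodal zero    {zero}  {suc j} _ ()
C-unimodal (suc N) {zero}  {suc j} _ (s≤s j≤N) = begin
  suc N C 0            ≡⟨ trans (nC0≡1 (suc N)) (sym (nC0≡1 N)) ⟩
  N C 0                ≤⟨ C-unimodal N z≤n j≤N ⟩
  N C j                ≤⟨ m≤m+n (N C j) (N C suc j) ⟩
  N C j + N C suc j    ≡⟨ nCk+nC[k+1]≡[n+1]C[k+1] N j ⟩
  suc N C suc j        ∎
  where open ≤-Reasoning
C-unimodal zero    {suc i} {suc j} _ ()
C-unimodal (suc N) {suc i} {suc j} (s≤s i≤j) (s≤s i+sj≤N) with suc (i + suc j) ≤? N
... | yes le = begin
  suc N C suc i      ≡⟨ nCk+nC[k+1]≡[n+1]C[k+1] N i ⟨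
  N C i + N C suc i  ≤⟨ +-mono-≤ (C-unimodal N i≤j (≤-trans (+-monoʳ-≤ i (n≤1+n j)) i+sj≤N)) (C-unimodal N (s≤s i≤j) le) ⟩
  N C j + N C suc j  ≡⟨ nCk+nC[k+1]≡[n+1]C[k+1] N j ⟩
  suc N C suc j      ∎
  where open ≤-Reasoning
... | no gt = ≤-reflexive (begin
  suc N C suc i              ≡⟨ nCk≡nC[n∸k] (s≤s (≤-trans (m≤m+n i (suc j)) i+sj≤N)) ⟩
  suc N C (N ∸ i)            ≡⟨ cong (λ z → suc N C (z ∸ i)) (≤-antisym (s≤s⁻¹ (≰⇒> gt)) i+sj≤N) ⟩
  suc N C (i + suc j ∸ i)    ≡⟨ cong (suc N C_) (m+n∸m≡n i (suc j)) ⟩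
  suc N C suc j              ∎)
  where open ≡-Reasoning

-- Telescoping of (i + 1) C(N, i + 1) − i C(N, i) = (N − 2i) C(N, i).
lower-levels : ∀ {N} j e → N ≡ 2 * j + e → e * (1 + Σ< (suc j) (nonempty N)) ≤ suc j * (N C suc j)
lower-levels {N} zero e N≡e = ≤-reflexive (begin
  e * 1          ≡⟨ cong (e *_) (nC0≡1 N) ⟨
  e * (N C 0)    ≡⟨ C-succ 0 e N≡e ⟨
  1 * (N C 1)    ∎)
  where open ≡-Reasoning
lower-levels {N} (suc j) e N≡ = begin
  e * (1 + (S + x))                    ≤⟨ m≤m+n _ (2 * (1 + S)) ⟩
  e * (1 + (S + x)) + 2 * (1 + S)      ≡⟨ regroup e S x ⟩
  (e + 2) * (1 + S) + e * x            ≤⟨ +-monoˡ-≤ (e * x) (lower-levels j (e + 2) (trans N≡ (shift j e))) ⟩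
  suc j * x + e * x                    ≡⟨ *-distribʳ-+ x (suc j) e ⟨
  (suc j + e) * x                      ≡⟨ C-succ (suc j) (suc j + e) (trans N≡ (double j e)) ⟨
  suc (suc j) * (N C suc (suc j))      ∎
  where
  open ≤-Reasoning
  S = Σ< (suc j) (nonempty N)
  x = N C suc j
  regroup : ∀ e S x → e * (1 + (S + x)) + 2 * (1 + S) ≡ (e + 2) * (1 + S) + e * x
  regroup = solve-∀
  shift : ∀ j e → 2 * suc j + e ≡ 2 * j + (e + 2)
  shift = solve-∀
  double : ∀ j e → 2 * suc j + e ≡ suc j + (suc j + e)
  double = solve-∀

-- The case d ≤ v, with f = g + 1, d = δ + 2 and v = d + e; G counts the nonempty sets of size below f.
module Narrow (g δ e : ℕ) where

  -- `N` is f d + (f + 1) e, which is (f + 1) v = N + d solved for `N` without subtraction.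
  N d v : ℕ
  N = suc g * (2 + δ) + (2 + g) * e
  d = 2 + δ
  v = d + e

  G : ℕ
  G = Σ< (suc g) (nonempty N)

  -- This is N - 2 g, the factor in `lower-levels` at level g.
  slack : ℕ
  slack = 2 + suc g * δ + (2 + g) * e

  slack*G≤ : slack * (1 + G) ≤ suc g * (N C suc g)
  slack*G≤ = lower-levels g slack (eq g δ e)
    where
    eq : ∀ g δ e → suc g * (2 + δ) + (2 + g) * e ≡ 2 * g + (2 + suc g * δ + (2 + g) * e)
    eq = solve-∀

  -- Yields `G ≤ B`: there are enough columns to give each small set one of its own.
  δ*G≤ : δ * G ≤ N C suc g
  δ*G≤ = *-cancelˡ-≤ (suc g) (≤-trans (≤-from ((2 + (2 + g) * e) * (1 + G) + suc g * δ) (eq g δ e G)) slack*G≤)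
    where
    eq : ∀ g δ e G → (2 + suc g * δ + (2 + g) * e) * (1 + G) ≡ suc g * (δ * G) + ((2 + (2 + g) * e) * (1 + G) + suc g * δ)
    eq = solve-∀

  next-level : (2 + g) * (N C (2 + g)) ≡ (suc g * suc δ + (2 + g) * e) * (N C suc g)
  next-level = C-succ (suc g) _ (eq g δ e)
    where
    eq : ∀ g δ e → suc g * (2 + δ) + (2 + g) * e ≡ suc g + (suc g * suc δ + (2 + g) * e)
    eq = solve-∀

-- The bounds on the number of parts of size f + 1, for d ≥ 3 and for d = 2. B is the number of columns
-- and K the total charge of the sets of size below f.
module Narrow≥3 (g δ e : ℕ) where
  open Narrow g (suc δ) e

  zeros-bound : ∀ B K → K ≤ d * G → d * B ≤ K + N C suc g → e * B + K ≤ N C (2 + g) + G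
  zeros-bound B K K≤ dB≤ = *-cancelˡ-≤ (2 + g) (*-cancelˡ-≤ d (begin
    d * ((2 + g) * (e * B + K))
      ≡⟨ eq₁ g d e B K ⟩
    (2 + g) * (e * (d * B) + d * K)
      ≤⟨ *-monoʳ-≤ (2 + g) (+-monoˡ-≤ (d * K) (*-monoʳ-≤ e dB≤)) ⟩
    (2 + g) * (e * (K + x) + d * K)
      ≡⟨ eq₂ g d e K x ⟩
    (2 + g) * e * x + (2 + g) * (v * K)
      ≤⟨ +-monoʳ-≤ ((2 + g) * e * x) (*-monoʳ-≤ (2 + g) (*-monoʳ-≤ v K≤)) ⟩
    (2 + g) * e * x + (2 + g) * (v * (d * G))
      -- With v d = (v - 1) d + d, the last summand matches the `G` on the right-hand side, and the
      -- rest must fit under a multiple of C(N, f).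
      ≡⟨ eq₃ g δ e G x ⟩
    (2 + g) * e * x + (coefficient * G + d * ((2 + g) * G))
      ≤⟨ +-monoʳ-≤ ((2 + g) * e * x) (+-monoˡ-≤ (d * ((2 + g) * G)) cleared) ⟩
    (2 + g) * e * x + ((2 + δ) * ((3 + δ) * suc g + (2 + g) * e) * x + d * ((2 + g) * G))
      ≡⟨ eq₄ g δ e G x ⟩
    d * ((suc g * suc (suc δ) + (2 + g) * e) * x + (2 + g) * G)
      ≡⟨ cong (λ z → d * (z + (2 + g) * G)) next-level ⟨
    d * ((2 + g) * (N C (2 + g)) + (2 + g) * G)
      ≡⟨ cong (d *_) (*-distribˡ-+ (2 + g) (N C (2 + g)) G) ⟨
    d * ((2 + g) * (N C (2 + g) + G)) ∎))
    where
    open ≤-Reasoning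
    x coefficient : ℕ
    x = N C suc g
    coefficient = (2 + g) * (3 + δ) * (2 + δ + e)
    eq₁ : ∀ g d e B K → d * ((2 + g) * (e * B + K)) ≡ (2 + g) * (e * (d * B) + d * K)
    eq₁ = solve-∀
    eq₂ : ∀ g d e K x → (2 + g) * (e * (K + x) + d * K) ≡ (2 + g) * e * x + (2 + g) * ((d + e) * K)
    eq₂ = solve-∀
    eq₃ : ∀ g δ e G x → (2 + g) * e * x + (2 + g) * ((3 + δ + e) * ((3 + δ) * G)) ≡
      (2 + g) * e * x + ((2 + g) * (3 + δ) * (2 + δ + e) * G + (3 + δ) * ((2 + g) * G))
    eq₃ = solve-∀
    eq₄ : ∀ g δ e G x →
      (2 + g) * e * x + ((2 + δ) * ((3 + δ) * suc g + (2 + g) * e) * x + (3 + δ) * ((2 + g) * G)) ≡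
      (3 + δ) * ((suc g * suc (suc δ) + (2 + g) * e) * x + (2 + g) * G)
    eq₄ = solve-∀
    -- The last summand is the difference of the two products, expanded; the inequality holds
    -- because no coefficient in it is negative.
    eq₅ : ∀ g δ e → (2 + δ) * ((3 + δ) * suc g + (2 + g) * e) * (2 + suc g * suc δ + (2 + g) * e) ≡
      suc g * ((2 + g) * (3 + δ) * (2 + δ + e)) +
      (6 + 18 * e + 6 * g + 11 * δ + 8 * e * e + 19 * e * g + 18 * e * δ + 17 * g * δ + 6 * δ * δ + 8 * e * e * g
       + 4 * e * e * δ + 5 * e * g * g + 23 * e * g * δ + 4 * e * δ * δ + 6 * g * g * δ + 11 * g * δ * δ + δ * δ * δ
       + 2 * e * e * g * g + 4 * e * e * g * δ + 7 * e * g * g * δ + 6 * e * g * δ * δ + 5 * g * g * δ * δ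
       + 2 * g * δ * δ * δ + e * e * g * g * δ + 2 * e * g * g * δ * δ + g * g * δ * δ * δ)
    eq₅ = solve-∀
    cleared : coefficient * G ≤ (2 + δ) * ((3 + δ) * suc g + (2 + g) * e) * x
    cleared = *-cancelˡ-≤ (suc g) (begin
      suc g * (coefficient * G)    ≡⟨ *-assoc (suc g) coefficient G ⟨
      suc g * coefficient * G      ≤⟨ *-mono-≤ {suc g * coefficient} {Y * slack} {G} {1 + G} (≤-from _ (eq₅ g δ e)) (n≤1+n G) ⟩
      Y * slack * (1 + G)          ≡⟨ *-assoc Y slack (1 + G) ⟩
      Y * (slack * (1 + G))        ≤⟨ *-monoʳ-≤ Y slack*G≤ ⟩
      Y * (suc g * x)              ≡⟨ eq₆ Y (suc g) x ⟩
      suc g * (Y * x)              ∎)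
      where
      Y = (2 + δ) * ((3 + δ) * suc g + (2 + g) * e)
      eq₆ : ∀ a b c → a * (b * c) ≡ b * (a * c)
      eq₆ = solve-∀

module Narrow2 (g e : ℕ) where
  open Narrow g 0 e

  zeros-bound : ∀ B → 2 * B ≤ 2 * G + N C suc g → e * B + nonempty N g ≤ N C (2 + g)
  zeros-bound B 2B≤ = go e refl
    where
    open ≤-Reasoning
    go : ∀ e′ → e ≡ e′ → e * B + nonempty N g ≤ N C (2 + g)
    -- Here N = 2 g + 2, so levels g and g + 2 are complementary.
    go zero e≡0 = begin
      e * B + nonempty N g   ≡⟨ cong (λ z → z * B + nonempty N g) e≡0 ⟩
      nonempty N g           ≤⟨ nonempty≤C N g ⟩
      N C g
        ≤⟨ C-unimodal N (m≤n+m g 2) (≤-reflexive (trans (eq g) (cong (λ z → suc g * 2 + (2 + g) * z) (sym e≡0)))) ⟩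
      N C (2 + g)            ∎
      where
      eq : ∀ g → g + (2 + g) ≡ suc g * 2 + (2 + g) * 0
      eq = solve-∀
    go (suc e′) e≡ = *-cancelˡ-≤ 2 (begin
      2 * (e * B + nonempty N g)              ≡⟨ eq₁ e B (nonempty N g) ⟩
      e * (2 * B) + 2 * nonempty N g          ≤⟨ +-mono-≤ (*-monoʳ-≤ e 2B≤) (≤-trans (*-monoʳ-≤ 2 (nonempty≤C N g)) 2C≤) ⟩
      e * (2 * G + x) + x
        ≤⟨ +-monoʳ-≤ (e * (2 * G + x)) (m≤n*m x e {{≢-nonZero (λ e≡0 → contradiction (trans (sym e≡0) e≡) λ ())}}) ⟩
      e * (2 * G + x) + e * x                 ≡⟨ eq₂ e G x ⟩
      2 * (e * (G + x))                       ≤⟨ *-monoʳ-≤ 2 (*-monoʳ-≤ e (n≤1+n (G + x))) ⟩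
      2 * (e * (1 + (G + x)))                 ≤⟨ *-monoʳ-≤ 2 top ⟩
      2 * (N C (2 + g))                       ∎)
      where
      x = N C suc g
      eq₁ : ∀ e B y → 2 * (e * B + y) ≡ e * (2 * B) + 2 * y
      eq₁ = solve-∀
      eq₂ : ∀ e G x → e * (2 * G + x) + e * x ≡ 2 * (e * (G + x))
      eq₂ = solve-∀
      eq₃ : ∀ g e → suc g * 2 + (2 + g) * suc e ≡ g + (suc g * 2 + (2 + (2 + g) * e))
      eq₃ = solve-∀
      2C≤ : 2 * (N C g) ≤ x
      2C≤ = *-cancelˡ-≤ (suc g) (begin
        suc g * (2 * (N C g))                        ≡⟨ *-assoc (suc g) 2 (N C g) ⟨
        suc g * 2 * (N C g)                          ≤⟨ *-monoˡ-≤ (N C g) (m≤m+n (suc g * 2) (2 + (2 + g) * e′)) ⟩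
        (suc g * 2 + (2 + (2 + g) * e′)) * (N C g)   ≡⟨ C-succ g _ (trans (cong (λ z → suc g * 2 + (2 + g) * z) e≡) (eq₃ g e′)) ⟨
        suc g * x                                    ∎)
      eq₄ : ∀ g e → suc g * 2 + (2 + g) * e ≡ 2 * suc g + (2 + g) * e
      eq₄ = solve-∀
      top : e * (1 + (G + x)) ≤ N C (2 + g)
      top = *-cancelˡ-≤ (2 + g) (≤-trans (≤-reflexive (sym (*-assoc (2 + g) e (1 + (G + x)))))
              (lower-levels (suc g) ((2 + g) * e) (eq₄ g e)))

-- The case d = v + 1, where v divides N + 1, with v = ν + 2 and f = h + 2.
module Wide (h ν : ℕ) where

  -- `N` is f v - 1: for d = v + 1, the equation (f + 1) v = N + d becomes f v = N + 1.
  N d v : ℕ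
  N = suc h * (2 + ν) + suc ν
  v = 2 + ν
  d = 3 + ν

  H x : ℕ
  H = Σ< (suc h) (nonempty N)
  x = N C suc h

  -- The factor is (N - f + 1) / f = v - 1. Hence levels f - 1 and f, with charges 2 and 1, together
  -- have capacity 2 x + (v - 1) x = d x.
  level-f : N C (2 + h) ≡ suc ν * x
  level-f = *-cancelˡ-≡ _ _ (2 + h) (trans (C-succ (suc h) ((2 + h) * suc ν) (eq h ν)) (*-assoc (2 + h) (suc ν) x))
    where
    eq : ∀ h ν → suc h * (2 + ν) + suc ν ≡ suc h + (2 + h) * suc ν
    eq = solve-∀

  H-bound : (3 + (2 + h) * ν) * (1 + H) ≤ suc h * x
  H-bound = lower-levels h (3 + (2 + h) * ν) (eq h ν)
    where
    eq : ∀ h ν → suc h * (2 + ν) + suc ν ≡ 2 * h + (3 + (2 + h) * ν)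
    eq = solve-∀

  ν*[1+H]≤x : ν * (1 + H) ≤ x
  ν*[1+H]≤x = *-cancelˡ-≤ (suc h) (≤-trans (≤-from ((3 + ν) * (1 + H)) (eq h ν H)) H-bound)
    where
    eq : ∀ h ν H → (3 + (2 + h) * ν) * (1 + H) ≡ suc h * (ν * (1 + H)) + (3 + ν) * (1 + H)
    eq = solve-∀

  -- B is the number of columns and P the number of columns that contain two parts of size f − 1.
  module _ (B K P : ℕ) (3H≤K : 3 * H ≤ K) (W< : K + d * x < d * B + d) (G≡ : H + x ≡ B + P) where

    -- Each set counted in `H` is charged at least 3, so `d * (H + x)` exceeds the capacity by at
    -- most (d - 3) `H`, and the capacity is below `d * B + d`.
    d*P< : d * P < ν * H + d
    d*P< = +-cancelˡ-< (d * B + 3 * H) _ _ (begin-strict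
      (d * B + 3 * H) + d * P       ≡⟨ eq₁ d B H P ⟩
      d * (B + P) + 3 * H           ≡⟨ cong (λ z → d * z + 3 * H) G≡ ⟨
      d * (H + x) + 3 * H           ≡⟨ eq₂ d H x ⟩
      d * H + (3 * H + d * x)       ≤⟨ +-monoʳ-≤ (d * H) (+-monoˡ-≤ (d * x) 3H≤K) ⟩
      d * H + (K + d * x)           <⟨ +-monoʳ-< (d * H) W< ⟩
      d * H + (d * B + d)           ≡⟨ eq₃ ν H B ⟩
      (d * B + 3 * H) + (ν * H + d) ∎)
      where
      open ≤-Reasoning
      eq₁ : ∀ d B H P → (d * B + 3 * H) + d * P ≡ d * (B + P) + 3 * H
      eq₁ = solve-∀
      eq₂ : ∀ d H x → d * (H + x) + 3 * H ≡ d * H + (3 * H + d * x)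
      eq₂ = solve-∀
      eq₃ : ∀ ν H B → (3 + ν) * H + ((3 + ν) * B + (3 + ν)) ≡ ((3 + ν) * B + 3 * H) + (ν * H + (3 + ν))
      eq₃ = solve-∀

    no-pairs : ν ≡ 0 → P ≡ 0
    no-pairs refl = n≤0⇒n≡0 (s≤s⁻¹ (*-cancelˡ-< 3 P 1 d*P<))

    -- From `d*P<` follows 3 P ≤ x + 2, which is enough for P ≥ 2. For P = 1, `no-pairs` gives ν >
    -- 0, and then `H-bound` rules out x ≤ 1.
    pairs-bound : 2 * P ≤ x
    pairs-bound = go P refl
      where
      open ≤-Reasoning
      3P≤ : 3 * P ≤ 2 + x
      3P≤ = ≤-trans (*-monoˡ-≤ P (m≤m+n 3 ν)) (s≤s⁻¹ (begin
        suc (d * P)          ≤⟨ d*P< ⟩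
        ν * H + (3 + ν)      ≡⟨ eq ν H ⟩
        3 + ν * (1 + H)      ≤⟨ +-monoʳ-≤ 3 ν*[1+H]≤x ⟩
        3 + x                ∎))
        where
        eq : ∀ ν H → ν * H + (3 + ν) ≡ 3 + ν * (1 + H)
        eq = solve-∀
      go : ∀ P′ → P ≡ P′ → 2 * P ≤ x
      go zero          refl = z≤n
      go (suc zero)    refl = ≰⇒> λ x≤1 → <-irrefl refl (begin-strict
        suc h * x                          ≤⟨ *-monoʳ-≤ (suc h) x≤1 ⟩
        suc h * 1                          <⟨ ≤-from 1 (eq h) ⟩
        3 + h
          ≤⟨ +-monoʳ-≤ 3 (≤-trans (m≤n+m h 2) (m≤m*n (2 + h) ν {{≢-nonZero λ ν≡0 → contradiction (no-pairs ν≡0) λ ()}})) ⟩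
        3 + (2 + h) * ν                    ≤⟨ m≤m*n (3 + (2 + h) * ν) (1 + H) ⟩
        (3 + (2 + h) * ν) * (1 + H)        ≤⟨ H-bound ⟩
        suc h * x                          ∎)
        where
        eq : ∀ h → 3 + h ≡ suc (suc h * 1) + 1
        eq = solve-∀
      go (suc (suc P″)) refl = +-cancelʳ-≤ 2 (2 * P) x (begin
        2 * P + 2    ≤⟨ +-monoʳ-≤ (2 * P) (s≤s (s≤s (z≤n {P″}))) ⟩
        2 * P + P    ≡⟨ +-comm (2 * P) P ⟩
        3 * P        ≤⟨ 3P≤ ⟩
        2 + x        ≡⟨ +-comm 2 x ⟩
        x + 2        ∎)

    x≤B : x ≤ B
    x≤B = s≤s⁻¹ (*-cancelˡ-< d x (suc B) (begin-strict
      d * x            ≤⟨ m≤n+m (d * x) K ⟩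
      K + d * x        <⟨ W< ⟩
      d * B + d        ≡⟨ trans (+-comm (d * B) d) (sym (*-suc d B)) ⟩
      d * suc B        ∎))
      where open ≤-Reasoning

-- Two steps up from level f - 1 against `H-bound`. This is for v ≥ 3; for v = 2 one has N = 2 f -
-- 1, and level f + 1 is only as large as level f - 2, which is part of `H`.
v*H≤ : ∀ h μ → let open Wide h (suc μ) in v * H ≤ N C (3 + h)
v*H≤ h μ = *-cancelˡ-≤ (3 + h) (*-cancelˡ-≤ (suc h) (begin
  suc h * ((3 + h) * (v * H))              ≡⟨ eq₁ h μ H ⟩
  suc h * ((3 + h) * (3 + μ)) * H
    ≤⟨ *-mono-≤ {suc h * ((3 + h) * (3 + μ))} {Y * (3 + (2 + h) * suc μ)} {H} {1 + H} (≤-from _ (eq₂ h μ)) (n≤1+n H) ⟩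
  Y * (3 + (2 + h) * suc μ) * (1 + H)      ≡⟨ *-assoc Y (3 + (2 + h) * suc μ) (1 + H) ⟩
  Y * ((3 + (2 + h) * suc μ) * (1 + H))    ≤⟨ *-monoʳ-≤ Y H-bound ⟩
  Y * (suc h * x)                          ≡⟨ eq₃ h μ x ⟩
  suc h * ((suc h * (2 + μ) + suc μ) * (suc (suc μ) * x))
    ≡⟨ cong (λ z → suc h * ((suc h * (2 + μ) + suc μ) * z)) level-f ⟨
  suc h * ((suc h * (2 + μ) + suc μ) * (N C (2 + h)))
    ≡⟨ cong (suc h *_) (C-succ (2 + h) (suc h * (2 + μ) + suc μ) (eq₄ h μ)) ⟨
  suc h * ((3 + h) * (N C (3 + h))) ∎))
  where
  open ≤-Reasoning
  open Wide h (suc μ)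
  Y = (suc h * (2 + μ) + suc μ) * (2 + μ)
  eq₁ : ∀ h μ H → suc h * ((3 + h) * ((3 + μ) * H)) ≡ suc h * ((3 + h) * (3 + μ)) * H
  eq₁ = solve-∀
  eq₂ : ∀ h μ → (suc h * (2 + μ) + suc μ) * (2 + μ) * (3 + (2 + h) * suc μ) ≡ suc h * ((3 + h) * (3 + μ)) +
    (21 + 14 * h + 44 * μ + h * h + 37 * h * μ + 24 * μ * μ + 7 * h * h * μ + 22 * h * μ * μ + 4 * μ * μ * μ
     + 5 * h * h * μ * μ + 4 * h * μ * μ * μ + h * h * μ * μ * μ)
  eq₂ = solve-∀
  eq₃ : ∀ h μ x → (suc h * (2 + μ) + suc μ) * (2 + μ) * (suc h * x) ≡ suc h * ((suc h * (2 + μ) + suc μ) * (suc (suc μ) * x))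
  eq₃ = solve-∀
  eq₄ : ∀ h μ → suc h * (2 + suc μ) + suc (suc μ) ≡ 2 + h + (suc h * (2 + μ) + suc μ)
  eq₄ = solve-∀

-- Part sizes

Φ : ∀ {A : Set} → (A → ℕ) → List A → ℕ
Φ φ []       = 0
Φ φ (x ∷ xs) = φ x + Φ φ xs

Φ-++ : ∀ {A : Set} (φ : A → ℕ) xs ys → Φ φ (xs ++ ys) ≡ Φ φ xs + Φ φ ys
Φ-++ φ []       ys = refl
Φ-++ φ (x ∷ xs) ys = trans (cong (φ x +_) (Φ-++ φ xs ys)) (sym (+-assoc (φ x) _ _))

Φ-replicate : ∀ {A : Set} (φ : A → ℕ) n x → Φ φ (replicate n x) ≡ n * φ x
Φ-replicate φ zero    x = refl
Φ-replicate φ (suc n) x = cong (φ x +_) (Φ-replicate φ n x)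

sum-lookup : ∀ {A : Set} (φ : A → ℕ) xs → sum (λ i → φ (List.lookup xs i)) ≡ Φ φ xs
sum-lookup φ []       = refl
sum-lookup φ (x ∷ xs) = cong (φ x +_) (sum-lookup φ xs)

Φ-const : ∀ {A : Set} {φ : A → ℕ} {c xs} → All (λ x → φ x ≡ c) xs → Φ φ xs ≡ length xs * c
Φ-const []       = refl
Φ-const (p ∷ ps) = cong₂ _+_ p (Φ-const ps)

Row : ℕ → ℕ → List ℕ → Set
Row N v row = Φ (λ _ → 1) row ≡ v × Φ (λ s → s) row ≡ N

entries : ∀ {N v} row → Row N v row → Σ (Fin v → ℕ) λ s → ∀ φ → sum (λ c → φ (s c)) ≡ Φ φ row
entries row (len , _) with trans (sym len) (ones row)
  where
  ones : ∀ row → Φ (λ _ → 1) row ≡ length row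
  ones []      = refl
  ones (_ ∷ r) = cong suc (ones r)
... | refl = List.lookup row , λ φ → sum-lookup φ row

realise-rows : ∀ {N v} (R : List (List ℕ)) → All (Row N v) R →
  (∀ j → Φ (Φ (λ s → δℕ s j)) R ≤ nonempty N j) → Σ (Array N (length R) v) IsLocating
realise-rows {N} {v} R rows bound = realise N size row-sum λ j → subst (_≤ nonempty N j) (sym (total (λ s → δℕ s j))) (bound j)
  where
  row : ∀ r → Row N v (List.lookup R r)
  row r = All.lookup rows (∈-lookup r)
  size : Fin (length R) → Fin v → ℕ
  size r = proj₁ (entries (List.lookup R r) (row r))
  row-sum : ∀ r → sum (size r) ≡ N
  row-sum r = trans (proj₂ (entries (List.lookup R r) (row r)) (λ s → s)) (proj₂ (row r))
  total : ∀ φ → sum (λ r → sum λ c → φ (size r c)) ≡ Φ (Φ φ) R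
  total φ = trans (sum-cong-≗ λ r → proj₂ (entries (List.lookup R r) (row r)) φ) (sum-lookup (Φ φ) R)

Σ<-zero : ∀ n {h} → (∀ i → i < n → h i ≡ 0) → Σ< n h ≡ 0
Σ<-zero zero    eq = refl
Σ<-zero (suc n) eq = cong₂ _+_ (Σ<-zero n λ i i<n → eq i (m<n⇒m<1+n i<n)) (eq n ≤-refl)

Σ<-unique : ∀ n h x → (∀ i → i < n → h i ≤ x) →
  (∀ i j → i < n → j < n → 1 ≤ h i → 1 ≤ h j → i ≡ j) → Σ< n h ≤ x
Σ<-unique zero    h x le unique = z≤n
Σ<-unique (suc n) h x le unique with h n in eq
... | zero  = ≤-trans (≤-reflexive (+-identityʳ (Σ< n h))) (Σ<-unique n h x (λ i i<n → le i (m<n⇒m<1+n i<n))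
                (λ i j i<n j<n → unique i j (m<n⇒m<1+n i<n) (m<n⇒m<1+n j<n)))
... | suc y = ≤-trans (+-monoˡ-≤ (suc y) (≤-reflexive (Σ<-zero n only-n))) (subst (_≤ x) eq (le n ≤-refl))
  where
  only-n : ∀ i → i < n → h i ≡ 0
  only-n i i<n with h i in eq′
  ... | zero  = refl
  ... | suc z = contradiction (unique i n (m<n⇒m<1+n i<n) ≤-refl (subst (1 ≤_) (sym eq′) (s≤s z≤n)) (subst (1 ≤_) (sym eq) (s≤s z≤n)))
                  (<⇒≢ i<n)

δℕ≤1 : ∀ i j → δℕ i j ≤ 1
δℕ≤1 i j with i ≟ j
... | yes _ = ≤-refl
... | no  _ = z≤n

-- f = g + 1 and F = f + 1. A part of size i has deficiency F ∸ i, and a column has total deficiency d.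
module Shapes (N v d g : ℕ) (2≤v : 2 ≤ v) (2≤d : 2 ≤ d) (d≤1+v : d ≤ suc v) (Fv : (2 + g) * v ≡ N + d) where

  f F : ℕ
  f = suc g
  F = suc f

  -- `zeros` counts the parts of size `F`, whose deficiency is 0. `large` is 1 if a part of size i
  -- alone exceeds the deficiency d; one part of size F + (w i - d) then compensates.
  w charge large zeros : ℕ → ℕ
  w i = F ∸ i
  charge i = d ⊓ w i
  large i = 1 ⊓ (w i ∸ d)
  zeros i = v ∸ 1 ∸ (d ∸ w i) ∸ large i

  a : ℕ → ℕ
  a = nonempty N

  small-row : ℕ → List ℕ
  small-row i = i ∷ replicate (d ∸ w i) f ++ replicate (zeros i) F ++ replicate (large i) (F + w i ∸ d)

  pair-row zero-row : List ℕ
  pair-row = g ∷ g ∷ replicate (d ∸ 4) f ++ replicate (v ∸ 2 ∸ (d ∸ 4)) F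
  zero-row = replicate d f ++ replicate (v ∸ d) F

  Φ-tail : ∀ φ x y z s → Φ φ (replicate x f ++ replicate y F ++ replicate z s) ≡ x * φ f + (y * φ F + z * φ s)
  Φ-tail φ x y z s = trans (Φ-++ φ (replicate x f) _) (cong₂ _+_ (Φ-replicate φ x f)
    (trans (Φ-++ φ (replicate y F) _) (cong₂ _+_ (Φ-replicate φ y F) (Φ-replicate φ z s))))

  Φ-two : ∀ φ x y → Φ φ (replicate x f ++ replicate y F) ≡ x * φ f + y * φ F
  Φ-two φ x y = trans (Φ-++ φ (replicate x f) _) (cong₂ _+_ (Φ-replicate φ x f) (Φ-replicate φ y F))

  small-row-valid : ∀ i → i < f → Row N v (small-row i)
  small-row-valid i i<f = trans (cong (1 +_) (Φ-tail _ (d ∸ w i) (zeros i) (large i) _)) len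
                        , trans (cong (i +_) (Φ-tail _ (d ∸ w i) (zeros i) (large i) _)) total
    where
    2≤w : 2 ≤ w i
    2≤w = ≤-trans (≤-reflexive (sym (m+n∸n≡m 2 i))) (∸-monoˡ-≤ i (s≤s i<f))
    i+w : i + w i ≡ F
    i+w = m+[n∸m]≡n (<⇒≤ (m<n⇒m<1+n i<f))
    few : (d ∸ w i) + large i ≤ v ∸ 1
    few with ≤-total d (w i)
    ... | inj₁ d≤w rewrite m≤n⇒m∸n≡0 d≤w = ≤-trans (m⊓n≤m 1 _) (∸-monoˡ-≤ 1 2≤v)
    ... | inj₂ w≤d rewrite m≤n⇒m∸n≡0 w≤d | +-identityʳ (d ∸ w i) = ∸-mono d≤1+v 2≤w
    z+ : (d ∸ w i) + (zeros i + large i) ≡ v ∸ 1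
    z+ = begin
      (d ∸ w i) + (v ∸ 1 ∸ (d ∸ w i) ∸ large i + large i)  ≡⟨ cong ((d ∸ w i) +_) (m∸n+n≡m (m+n≤o⇒n≤o∸m (d ∸ w i) few)) ⟩
      (d ∸ w i) + (v ∸ 1 ∸ (d ∸ w i))                      ≡⟨ m+[n∸m]≡n (m+n≤o⇒m≤o (d ∸ w i) few) ⟩
      v ∸ 1                                                ∎
      where
      open ≡-Reasoning
      m+n≤o⇒n≤o∸m : ∀ m {n o} → m + n ≤ o → n ≤ o ∸ m
      m+n≤o⇒n≤o∸m m {n} {o} le = m+n≤o⇒m≤o∸n n (subst (_≤ o) (+-comm m n) le)
    1+[v∸1] : 1 + (v ∸ 1) ≡ v
    1+[v∸1] = m+[n∸m]≡n (≤-trans (s≤s z≤n) 2≤v)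
    len : 1 + ((d ∸ w i) * 1 + (zeros i * 1 + large i * 1)) ≡ v
    len rewrite *-identityʳ (d ∸ w i) | *-identityʳ (zeros i) | *-identityʳ (large i) | z+ = 1+[v∸1]
    large-part : large i * (F + w i ∸ d) ≡ large i * F + (w i ∸ d)
    large-part with ≤-total d (w i)
    ... | inj₂ w≤d rewrite m≤n⇒m∸n≡0 w≤d = refl
    ... | inj₁ d≤w rewrite +-∸-assoc F d≤w with w i ∸ d
    ...   | zero  = refl
    ...   | suc x = trans (+-identityʳ _) (cong (_+ suc x) (sym (+-identityʳ F)))
    max : (w i ∸ d) + d ≡ (d ∸ w i) + w i
    max with ≤-total d (w i)
    ... | inj₁ d≤w rewrite m≤n⇒m∸n≡0 d≤w = m∸n+n≡m d≤w
    ... | inj₂ w≤d rewrite m≤n⇒m∸n≡0 w≤d = sym (m∸n+n≡m w≤d)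
    total : i + ((d ∸ w i) * f + (zeros i * F + large i * (F + w i ∸ d))) ≡ N
    total = +-cancelʳ-≡ d _ _ (begin
      i + (x * f + (zeros i * F + large i * (F + w i ∸ d))) + d
        ≡⟨ cong (λ t → i + (x * f + (zeros i * F + t)) + d) large-part ⟩
      i + (x * f + (zeros i * F + (large i * F + (w i ∸ d)))) + d
        ≡⟨ regroup i (x * f) (zeros i) (large i) F (w i ∸ d) d ⟩
      i + x * f + (zeros i + large i) * F + ((w i ∸ d) + d)
        ≡⟨ cong (λ t → i + x * f + (zeros i + large i) * F + t) max ⟩
      i + x * f + (zeros i + large i) * F + (x + w i)
        ≡⟨ regroup′ i x f (zeros i + large i) (w i) ⟩
      (i + w i) + (x + (zeros i + large i)) * F
        ≡⟨ cong₂ (λ s t → s + t * F) i+w z+ ⟩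
      (1 + (v ∸ 1)) * F
        ≡⟨ cong (_* F) 1+[v∸1] ⟩
      v * F
        ≡⟨ trans (*-comm v F) Fv ⟩
      N + d ∎)
      where
      open ≡-Reasoning
      x = d ∸ w i
      regroup : ∀ i y z l F t d → i + (y + (z * F + (l * F + t))) + d ≡ i + y + (z + l) * F + (t + d)
      regroup = solve-∀
      regroup′ : ∀ i x f z w → i + x * f + z * suc f + (x + w) ≡ (i + w) + (x + z) * suc f
      regroup′ = solve-∀

  pair-row-valid : 4 ≤ d → Row N v pair-row
  pair-row-valid 4≤d = trans (cong (2 +_) (Φ-two _ (d ∸ 4) (v ∸ 2 ∸ (d ∸ 4)))) len
                     , trans (cong (λ t → g + (g + t)) (Φ-two _ (d ∸ 4) (v ∸ 2 ∸ (d ∸ 4)))) total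
    where
    y z : ℕ
    y = d ∸ 4
    z = v ∸ 2 ∸ y
    y+z : y + z ≡ v ∸ 2
    y+z = m+[n∸m]≡n (≤-trans (∸-monoˡ-≤ 4 d≤1+v) (∸-monoʳ-≤ v (s≤s (s≤s (z≤n {1})))))
    v≡ : 2 + (y + z) ≡ v
    v≡ = trans (cong (2 +_) y+z) (m+[n∸m]≡n 2≤v)
    len : 2 + (y * 1 + z * 1) ≡ v
    len = trans (cong₂ (λ s t → 2 + (s + t)) (*-identityʳ y) (*-identityʳ z)) v≡
    total : g + (g + (y * f + z * F)) ≡ N
    total = +-cancelʳ-≡ d _ _ (begin
      g + (g + (y * f + z * F)) + d              ≡⟨ cong (g + (g + (y * f + z * F)) +_) (m∸n+n≡m 4≤d) ⟨
      g + (g + (y * f + z * F)) + (y + 4)        ≡⟨ regroup g y z ⟩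
      (2 + g) * (2 + (y + z))                    ≡⟨ trans (cong ((2 + g) *_) v≡) Fv ⟩
      N + d                                      ∎)
      where
      open ≡-Reasoning
      regroup : ∀ g y z → g + (g + (y * suc g + z * (2 + g))) + (y + 4) ≡ (2 + g) * (2 + (y + z))
      regroup = solve-∀

  zero-row-valid : d ≤ v → Row N v zero-row
  zero-row-valid d≤v = trans (Φ-two _ d (v ∸ d)) (trans (cong₂ _+_ (*-identityʳ d) (*-identityʳ (v ∸ d))) (m+[n∸m]≡n d≤v))
                     , trans (Φ-two _ d (v ∸ d)) total
    where
    total : d * f + (v ∸ d) * F ≡ N
    total = +-cancelʳ-≡ d _ _ (begin
      d * f + (v ∸ d) * F + d   ≡⟨ regroup d f (v ∸ d) ⟩
      F * (d + (v ∸ d))         ≡⟨ trans (cong (F *_) (m+[n∸m]≡n d≤v)) Fv ⟩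
      N + d                     ∎)
      where
      open ≡-Reasoning
      regroup : ∀ d f z → d * f + z * suc f + d ≡ suc f * (d + z)
      regroup = solve-∀

  small-rows : ℕ → List (List ℕ)
  small-rows zero    = []
  small-rows (suc i) = small-rows i ++ replicate (a i) (small-row i)

  small-rows-valid : ∀ j → j ≤ f → All (Row N v) (small-rows j)
  small-rows-valid zero    _   = []
  small-rows-valid (suc j) j<f = ++⁺ (small-rows-valid j (<⇒≤ j<f)) (replicate⁺ (a j) (small-row-valid j j<f))

  Φ-small-rows : ∀ ψ j → Φ ψ (small-rows j) ≡ Σ< j (λ i → a i * ψ (small-row i))
  Φ-small-rows ψ zero    = refl
  Φ-small-rows ψ (suc j) = trans (Φ-++ ψ (small-rows j) _) (cong₂ _+_ (Φ-small-rows ψ j) (Φ-replicate ψ (a j) (small-row j)))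

  G K Big : ℕ
  G = Σ< f a
  K = Σ< f (λ i → charge i * a i)
  Big = Σ< g (λ i → a i * large i)

  2≤w : ∀ {i} → i < f → 2 ≤ w i
  2≤w {i} i<f = ≤-trans (≤-reflexive (sym (m+n∸n≡m 2 i))) (∸-monoˡ-≤ i (s≤s i<f))

  w-g : w g ≡ 2
  w-g = m+n∸n≡m 2 g

  charge-g : charge g ≡ 2
  charge-g = trans (cong (d ⊓_) w-g) (m≥n⇒m⊓n≡n 2≤d)

  large-g : large g ≡ 0
  large-g = trans (cong (1 ⊓_) (trans (cong (_∸ d) w-g) (m≤n⇒m∸n≡0 2≤d))) refl

  -- P columns contain two parts of size f − 1, and Q columns have no part of size below f.
  module _ (B P Q : ℕ) (G+Q : G + Q ≡ B + P) (2P≤ : 2 * P ≤ a g) (P-ok : P ≡ 0 ⊎ 4 ≤ d) (Q-ok : Q ≡ 0 ⊎ d ≤ v)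
           (dB≤ : d * B ≤ K + a f) (zeros-bound : v * B + K ≤ a F + (d * B + (G + Big))) where

    singles : ℕ
    singles = a g ∸ 2 * P

    singles+ : singles + 2 * P ≡ a g
    singles+ = m∸n+n≡m 2P≤

    rows : List (List ℕ)
    rows = small-rows g ++ (replicate singles (small-row g) ++ (replicate P pair-row ++ replicate Q zero-row))

    replicate-ok : ∀ {m row} → m ≡ 0 ⊎ Row N v row → All (Row N v) (replicate m row)
    replicate-ok         (inj₁ refl) = []
    replicate-ok {m = m} (inj₂ ok) = replicate⁺ m ok

    rows-valid : All (Row N v) rows
    rows-valid = ++⁺ (small-rows-valid g (n≤1+n g)) (++⁺ (replicate⁺ singles (small-row-valid g ≤-refl))
      (++⁺ (replicate-ok (map₂ pair-row-valid P-ok)) (replicate-ok (map₂ zero-row-valid Q-ok))))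

    ones-count zeros-count : ℕ
    ones-count = Σ< g (λ i → a i * (d ∸ w i)) + (singles * (d ∸ 2) + (P * (d ∸ 4) + Q * d))
    zeros-count = Σ< g (λ i → a i * zeros i) + (singles * zeros g + (P * (v ∸ 2 ∸ (d ∸ 4)) + Q * (v ∸ d)))

    Φ-rows : ∀ ψ → Φ ψ rows ≡ Σ< g (λ i → a i * ψ (small-row i)) + (singles * ψ (small-row g) + (P * ψ pair-row + Q * ψ zero-row))
    Φ-rows ψ = trans (Φ-++ ψ (small-rows g) _) (cong₂ _+_ (Φ-small-rows ψ g)
      (trans (Φ-++ ψ (replicate singles (small-row g)) _) (cong₂ _+_ (Φ-replicate ψ singles (small-row g))
        (trans (Φ-++ ψ (replicate P pair-row) _) (cong₂ _+_ (Φ-replicate ψ P pair-row) (Φ-replicate ψ Q zero-row))))))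

    -- Used with the constant 1 for the number of parts and with `δℕ` for the frequency of a size.
    -- Level g joins the first sum because `singles + 2 * P` exhausts it.
    total : ∀ φ → Φ (Φ φ) rows ≡
      Σ< f (λ i → a i * φ i) + (ones-count * φ f + (zeros-count * φ F + Σ< g (λ i → a i * (large i * φ (F + w i ∸ d)))))
    total φ = begin
      Φ (Φ φ) rows
        ≡⟨ Φ-rows (Φ φ) ⟩
      Σ< g (λ i → a i * Φ φ (small-row i)) + (singles * Φ φ (small-row g) + (P * Φ φ pair-row + Q * Φ φ zero-row))
        ≡⟨ cong₂ _+_ small (cong₂ _+_ (cong (singles *_) g-row) (cong₂ _+_ (cong (P *_) (cong (λ t → φ g + (φ g + t)) (Φ-two φ (d ∸ 4) z₂)))
             (cong (Q *_) (Φ-two φ d z₃)))) ⟩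
      (T₀ + (T₁ * φ f + (T₂ * φ F + T₃))) +
        (singles * (φ g + ((d ∸ 2) * φ f + zeros g * φ F)) + (P * (φ g + (φ g + ((d ∸ 4) * φ f + z₂ * φ F))) + Q * (d * φ f + z₃ * φ F)))
        ≡⟨ regroup T₀ T₁ T₂ T₃ singles P Q (φ g) (φ f) (φ F) (d ∸ 2) (zeros g) (d ∸ 4) z₂ d z₃ ⟩
      (T₀ + (singles + 2 * P) * φ g) + (ones-count * φ f + (zeros-count * φ F + T₃))
        ≡⟨ cong (λ t → (T₀ + t * φ g) + (ones-count * φ f + (zeros-count * φ F + T₃))) singles+ ⟩
      Σ< f (λ i → a i * φ i) + (ones-count * φ f + (zeros-count * φ F + T₃)) ∎
      where
      open ≡-Reasoning
      z₂ = v ∸ 2 ∸ (d ∸ 4)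
      z₃ = v ∸ d
      T₀ = Σ< g (λ i → a i * φ i)
      T₁ = Σ< g (λ i → a i * (d ∸ w i))
      T₂ = Σ< g (λ i → a i * zeros i)
      T₃ = Σ< g (λ i → a i * (large i * φ (F + w i ∸ d)))
      g-row : Φ φ (small-row g) ≡ φ g + ((d ∸ 2) * φ f + zeros g * φ F)
      g-row = cong (φ g +_) (trans (Φ-tail φ (d ∸ w g) (zeros g) (large g) _)
        (cong₂ _+_ (cong (λ t → (d ∸ t) * φ f) w-g) (trans (cong (λ t → zeros g * φ F + t * φ (F + w g ∸ d)) large-g) (+-identityʳ _))))
      expand : ∀ a p x y s t q r → a * (p + (x * q + (y * r + s * t))) ≡ a * p + (q * (a * x) + (r * (a * y) + a * (s * t)))
      expand = solve-∀
      small : Σ< g (λ i → a i * Φ φ (small-row i)) ≡ T₀ + (T₁ * φ f + (T₂ * φ F + T₃))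
      small = begin
        Σ< g (λ i → a i * Φ φ (small-row i))
          ≡⟨ Σ<-cong g (λ i _ → trans (cong (λ t → a i * (φ i + t)) (Φ-tail φ (d ∸ w i) (zeros i) (large i) _))
               (expand (a i) (φ i) (d ∸ w i) (zeros i) (large i) _ (φ f) (φ F))) ⟩
        Σ< g (λ i → a i * φ i + (φ f * (a i * (d ∸ w i)) + (φ F * (a i * zeros i) + a i * (large i * φ (F + w i ∸ d)))))
          ≡⟨ trans (Σ<-+ g (λ i → a i * φ i) _) (cong (T₀ +_) (trans (Σ<-+ g (λ i → φ f * (a i * (d ∸ w i))) _)
               (cong₂ _+_ (trans (Σ<-* g (φ f) _) (*-comm (φ f) T₁))
                 (trans (Σ<-+ g (λ i → φ F * (a i * zeros i)) _) (cong (_+ T₃) (trans (Σ<-* g (φ F) _) (*-comm (φ F) T₂))))))) ⟩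
        T₀ + (T₁ * φ f + (T₂ * φ F + T₃)) ∎
      regroup : ∀ T₀ T₁ T₂ T₃ m P Q p q r x₁ y₁ x₂ y₂ x₃ y₃ →
        (T₀ + (T₁ * q + (T₂ * r + T₃))) + (m * (p + (x₁ * q + y₁ * r)) + (P * (p + (p + (x₂ * q + y₂ * r))) + Q * (x₃ * q + y₃ * r)))
        ≡ (T₀ + (m + 2 * P) * p) + ((T₁ + (m * x₁ + (P * x₂ + Q * x₃))) * q + ((T₂ + (m * y₁ + (P * y₂ + Q * y₃))) * r + T₃))
      regroup = solve-∀

    rows-length : length rows ≡ B
    rows-length = +-cancelʳ-≡ P (length rows) B (begin
      length rows + P
        ≡⟨ cong (_+ P) (trans (sym (trans (Φ-const {c = 1} (All.universal (λ _ → refl) rows)) (*-identityʳ _)))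
                            (Φ-rows (λ _ → 1))) ⟩
      Σ< g (λ i → a i * 1) + (singles * 1 + (P * 1 + Q * 1)) + P
        ≡⟨ cong (λ t → t + (singles * 1 + (P * 1 + Q * 1)) + P) (Σ<-cong g λ i _ → *-identityʳ (a i)) ⟩
      Σ< g a + (singles * 1 + (P * 1 + Q * 1)) + P           ≡⟨ regroup (Σ< g a) singles P Q ⟩
      Σ< g a + (singles + 2 * P) + Q                         ≡⟨ cong (λ t → Σ< g a + t + Q) singles+ ⟩
      G + Q                                                  ≡⟨ G+Q ⟩
      B + P                                                  ∎)
      where
      open ≡-Reasoning
      regroup : ∀ H m P Q → H + (m * 1 + (P * 1 + Q * 1)) + P ≡ H + (m + 2 * P) + Q
      regroup = solve-∀

    -- The charges in each row add up to exactly `d`, and a part of size `f` has charge 1. Therefore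
    -- `ones≤` is just `dB≤` rearranged.
    ones+K : ones-count + K ≡ d * B
    ones+K = +-cancelʳ-≡ (d * P) _ _ (begin
      (T₁ + (singles * (d ∸ 2) + (P * (d ∸ 4) + Q * d))) + (K₀ + charge g * a g) + d * P
        ≡⟨ cong₂ (λ s t → (T₁ + (singles * (d ∸ 2) + (P * (d ∸ 4) + Q * d))) + (K₀ + s * t) + d * P) charge-g (sym singles+) ⟩
      (T₁ + (singles * (d ∸ 2) + (P * (d ∸ 4) + Q * d))) + (K₀ + 2 * (singles + 2 * P)) + d * P
        ≡⟨ regroup T₁ K₀ singles P Q (d ∸ 2) (d ∸ 4) d ⟩
      (T₁ + K₀) + (singles * ((d ∸ 2) + 2) + (P * ((d ∸ 4) + 4) + (P * d + Q * d)))
        ≡⟨ cong₂ (λ s t → s + (singles * t + (P * ((d ∸ 4) + 4) + (P * d + Q * d)))) T₁+K₀ (m∸n+n≡m 2≤d) ⟩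
      d * Σ< g a + (singles * d + (P * ((d ∸ 4) + 4) + (P * d + Q * d)))
        ≡⟨ cong (λ t → d * Σ< g a + (singles * d + (t + (P * d + Q * d)))) (pairs P-ok) ⟩
      d * Σ< g a + (singles * d + (P * d + (P * d + Q * d)))
        ≡⟨ regroup′ d (Σ< g a) singles P Q ⟩
      d * (Σ< g a + (singles + 2 * P) + Q)
        ≡⟨ cong (λ t → d * (Σ< g a + t + Q)) singles+ ⟩
      d * (G + Q)
        ≡⟨ trans (cong (d *_) G+Q) (*-distribˡ-+ d B P) ⟩
      d * B + d * P ∎)
      where
      open ≡-Reasoning
      T₁ = Σ< g (λ i → a i * (d ∸ w i))
      K₀ = Σ< g (λ i → charge i * a i)
      T₁+K₀ : T₁ + K₀ ≡ d * Σ< g a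
      T₁+K₀ = trans (sym (Σ<-+ g (λ i → a i * (d ∸ w i)) _)) (trans (Σ<-cong g λ i _ → cell i) (Σ<-* g d a))
        where
        ∸+⊓ : ∀ m n → (m ∸ n) + m ⊓ n ≡ m
        ∸+⊓ m n = trans (+-comm (m ∸ n) (m ⊓ n)) (trans (cong (_+ (m ∸ n)) (⊓-comm m n)) (m⊓n+n∸m≡n n m))
        cell : ∀ i → a i * (d ∸ w i) + charge i * a i ≡ d * a i
        cell i = trans (cong (_+ charge i * a i) (*-comm (a i) (d ∸ w i))) (trans (sym (*-distribʳ-+ (a i) (d ∸ w i) (charge i)))
                   (cong (_* a i) (∸+⊓ d (w i))))
      pairs : P ≡ 0 ⊎ 4 ≤ d → P * ((d ∸ 4) + 4) ≡ P * d
      pairs (inj₁ P≡0) = trans (cong (_* ((d ∸ 4) + 4)) P≡0) (sym (cong (_* d) P≡0))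
      pairs (inj₂ 4≤d) = cong (P *_) (m∸n+n≡m 4≤d)
      regroup : ∀ S K m P Q x y d →
        (S + (m * x + (P * y + Q * d))) + (K + 2 * (m + 2 * P)) + d * P ≡ (S + K) + (m * (x + 2) + (P * (y + 4) + (P * d + Q * d)))
      regroup = solve-∀
      regroup′ : ∀ d H m P Q → d * H + (m * d + (P * d + (P * d + Q * d))) ≡ d * (H + (m + 2 * P) + Q)
      regroup′ = solve-∀

    -- The parts of size `F` are what the other kinds leave of all `v * B` parts; `zeros-bound` is
    -- this count with the subtractions cleared.
    zeros≤ : zeros-count ≤ a F
    zeros≤ = +-cancelʳ-≤ (d * B + (G + Big)) zeros-count (a F) (≤-trans (≤-reflexive balance) zeros-bound)
      where
      open ≡-Reasoning
      all-entries : G + (ones-count + (zeros-count + Big)) ≡ v * B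
      all-entries = begin
        G + (ones-count + (zeros-count + Big))
          ≡⟨ cong₂ _+_ (Σ<-cong f λ i _ → sym (*-identityʳ (a i))) (cong₂ _+_ (sym (*-identityʳ ones-count))
               (cong₂ _+_ (sym (*-identityʳ zeros-count)) (Σ<-cong g λ i _ → cong (a i *_) (sym (*-identityʳ (large i)))))) ⟩
        _
          ≡⟨ total (λ _ → 1) ⟨
        Φ (Φ (λ _ → 1)) rows
          ≡⟨ Φ-const (All.map proj₁ rows-valid) ⟩
        length rows * v
          ≡⟨ trans (cong (_* v) rows-length) (*-comm B v) ⟩
        v * B ∎
      swap : ∀ z o K G b → z + ((o + K) + (G + b)) ≡ (G + (o + (z + b))) + K
      swap = solve-∀
      balance : zeros-count + (d * B + (G + Big)) ≡ v * B + K
      balance = begin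
        zeros-count + (d * B + (G + Big))                 ≡⟨ cong (λ t → zeros-count + (t + (G + Big))) ones+K ⟨
        zeros-count + ((ones-count + K) + (G + Big))      ≡⟨ swap zeros-count ones-count K G Big ⟩
        G + (ones-count + (zeros-count + Big)) + K        ≡⟨ cong (_+ K) all-entries ⟩
        v * B + K                                         ∎

    ones≤ : ones-count ≤ a f
    ones≤ = +-cancelʳ-≤ K ones-count (a f) (≤-trans (≤-reflexive ones+K) (≤-trans dB≤ (≤-reflexive (+-comm K (a f)))))

    small-part : ∀ j → Σ< f (λ i → a i * δℕ i j) ≤ a j
    small-part j = Σ<-unique f _ (a j) (λ i _ → cell i) λ i i′ _ _ p p′ → trans (hit i p) (sym (hit i′ p′))
      where
      cell : ∀ i → a i * δℕ i j ≤ a j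
      cell i with i ≟ j
      ... | yes refl = ≤-reflexive (*-identityʳ (a i))
      ... | no  _    = ≤-trans (≤-reflexive (*-zeroʳ (a i))) z≤n
      hit : ∀ i → 1 ≤ a i * δℕ i j → i ≡ j
      hit i p with i ≟ j
      ... | yes eq = eq
      ... | no  _  = contradiction (subst (1 ≤_) (*-zeroʳ (a i)) p) λ ()

    small-part-0 : ∀ j → f ≤ j → Σ< f (λ i → a i * δℕ i j) ≡ 0
    small-part-0 j f≤j = Σ<-zero f λ i i<f → trans (cong (a i *_) (δℕ-≢ (<⇒≢ (<-≤-trans i<f f≤j)))) (*-zeroʳ (a i))

    large-part : ℕ → ℕ
    large-part j = Σ< g (λ i → a i * (large i * δℕ (F + w i ∸ d) j))

    large-hit : ∀ i j → 1 ≤ a i * (large i * δℕ (F + w i ∸ d) j) → d < w i × F + w i ∸ d ≡ j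
    large-hit i j p with w i ≤? d
    ... | yes w≤d rewrite m≤n⇒m∸n≡0 w≤d | *-zeroʳ (a i) = contradiction p λ ()
    ... | no  w≰d with (F + w i ∸ d) ≟ j
    ...   | yes eq = ≰⇒> w≰d , eq
    ...   | no  _  rewrite *-zeroʳ (large i) | *-zeroʳ (a i) = contradiction p λ ()

    w-injective : ∀ {i i′} → i < g → i′ < g → w i ≡ w i′ → i ≡ i′
    w-injective i<g i′<g eq = ∸-cancelˡ-≡ (≤-trans (<⇒≤ i<g) (m≤n+m g 2)) (≤-trans (<⇒≤ i′<g) (m≤n+m g 2)) eq

    -- Different small sizes produce different large sizes, so size j stems from a single i. Then i
    -- + j = 2 F - d ≤ v F - d = N, and `C-unimodal` applies.
    large-part≤ : ∀ j → large-part j ≤ a j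
    large-part≤ j = Σ<-unique g _ (a j) cell λ i i′ i<g i′<g p p′ → w-injective i<g i′<g (same-w i i′ p p′)
      where
      same-w : ∀ i i′ → _ → _ → w i ≡ w i′
      same-w i i′ p p′ with large-hit i j p | large-hit i′ j p′
      ... | d<w , eq | d<w′ , eq′ = +-cancelˡ-≡ F _ _
          (∸-cancelʳ-≡ (≤-trans (<⇒≤ d<w) (m≤n+m _ F)) (≤-trans (<⇒≤ d<w′) (m≤n+m _ F)) (trans eq (sym eq′)))
      bounded : ∀ i → i < g → d < w i × F + w i ∸ d ≡ j → a i ≤ a j
      bounded i i<g (d<w , refl) = ≤-trans (nonempty≤C N i) (≤-trans (C-unimodal N i≤j i+j≤N) (≤-reflexive (C≡a _ 1≤j)))
        where
        F≤j : F ≤ F + w i ∸ d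
        F≤j = ≤-trans (m≤m+n F (w i ∸ d)) (≤-reflexive (sym (+-∸-assoc F (<⇒≤ d<w))))
        i≤j : i ≤ F + w i ∸ d
        i≤j = ≤-trans (≤-trans (<⇒≤ i<g) (m≤n+m g 2)) F≤j
        1≤j : 1 ≤ F + w i ∸ d
        1≤j = ≤-trans (s≤s z≤n) F≤j
        C≡a : ∀ j → 1 ≤ j → N C j ≡ a j
        C≡a (suc j) _ = refl
        open ≤-Reasoning
        swap : ∀ i x F → i + (F + x) ≡ F + (i + x)
        swap = solve-∀
        i+j≤N : i + (F + w i ∸ d) ≤ N
        i+j≤N = +-cancelʳ-≤ d _ N (begin
          i + (F + w i ∸ d) + d    ≡⟨ +-assoc i (F + w i ∸ d) d ⟩
          i + (F + w i ∸ d + d)    ≡⟨ cong (i +_) (m∸n+n≡m (≤-trans (<⇒≤ d<w) (m≤n+m (w i) F))) ⟩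
          i + (F + w i)            ≡⟨ swap i (w i) F ⟩
          F + (i + w i)            ≡⟨ cong (F +_) (m+[n∸m]≡n (≤-trans (<⇒≤ i<g) (m≤n+m g 2))) ⟩
          F + F                    ≡⟨ trans (cong (F +_) (sym (+-identityʳ F))) (*-comm 2 F) ⟩
          F * 2                    ≤⟨ *-monoʳ-≤ F 2≤v ⟩
          F * v                    ≡⟨ Fv ⟩
          N + d                    ∎)
      cell : ∀ i → i < g → a i * (large i * δℕ (F + w i ∸ d) j) ≤ a j
      cell i i<g with a i * (large i * δℕ (F + w i ∸ d) j) in eq
      ... | zero  = z≤n
      ... | suc x = begin
        suc x                                       ≡⟨ eq ⟨
        a i * (large i * δℕ (F + w i ∸ d) j)        ≤⟨ *-monoʳ-≤ (a i) (*-mono-≤ (m⊓n≤m 1 (w i ∸ d)) (δℕ≤1 _ j)) ⟩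
        a i * 1                                     ≡⟨ *-identityʳ (a i) ⟩
        a i                                         ≤⟨ bounded i i<g (large-hit i j (subst (1 ≤_) (sym eq) (s≤s z≤n))) ⟩
        a j                                         ∎
        where open ≤-Reasoning

    large-part-0 : ∀ j → j ≤ F → large-part j ≡ 0
    large-part-0 j j≤F = Σ<-zero g λ i _ → n≤0⇒n≡0 (s≤s⁻¹ (≰⇒> (miss i)))
      where
      miss : ∀ i → ¬ (1 ≤ a i * (large i * δℕ (F + w i ∸ d) j))
      miss i p with large-hit i j p
      ... | d<w , eq = <-irrefl refl (≤-<-trans j≤F (<-≤-trans (m<m+n F (m<n⇒0<n∸m d<w))
                         (≤-reflexive (trans (sym (+-∸-assoc F (<⇒≤ d<w))) eq))))

    counts : ∀ j → Φ (Φ (λ s → δℕ s j)) rows ≤ a j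
    counts j rewrite total (λ s → δℕ s j) with <-cmp j F
    ... | tri> _ _ F<j
      rewrite small-part-0 j (<⇒≤ (<-trans ≤-refl F<j)) | δℕ-≢ (<⇒≢ (<-trans ≤-refl F<j)) | δℕ-≢ (<⇒≢ F<j)
            | *-zeroʳ ones-count | *-zeroʳ zeros-count = large-part≤ j
    ... | tri≈ _ refl _
      rewrite small-part-0 F (n≤1+n f) | δℕ-≢ {f} {F} (<⇒≢ ≤-refl) | δℕ-refl F | large-part-0 F ≤-refl
            | *-zeroʳ ones-count | *-identityʳ zeros-count | +-identityʳ zeros-count = zeros≤
    ... | tri< j<F _ _ with j ≟ f
    ...   | yes refl
      rewrite small-part-0 f ≤-refl | δℕ-refl f | δℕ-≢ {F} {f} (<⇒≢ ≤-refl ∘ sym) | large-part-0 f (n≤1+n f)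
            | *-identityʳ ones-count | *-zeroʳ zeros-count | +-identityʳ ones-count = ones≤
    ...   | no j≢f
      rewrite δℕ-≢ {f} {j} (j≢f ∘ sym) | δℕ-≢ {F} {j} (<⇒≢ j<F ∘ sym) | large-part-0 j (<⇒≤ j<F)
            | *-zeroʳ ones-count | *-zeroʳ zeros-count | +-identityʳ (Σ< f (λ i → a i * δℕ i j)) = small-part j

    columns : Σ (Array N B v) IsLocating
    columns = subst (λ k → Σ (Array N k v) IsLocating) rows-length (realise-rows rows rows-valid counts)

-- The columns for d ≤ v and for d = v + 1

columns-narrow : ∀ g δ e B → let open Narrow g δ e in
  let W = Σ< (suc g) (λ i → (d ⊓ (2 + g ∸ i)) * nonempty N i) + nonempty N (suc g) in
  d * B ≤ W → W < d * B + d → Σ (Array N B v) IsLocating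
columns-narrow g δ e B dB≤W W< =
  -- No pairs are needed; the `B ∸ G` columns without a small set use sizes `f` and `F` only, as d ≤
  -- v permits.
  columns B 0 (B ∸ G) (trans (m+[n∸m]≡n G≤B) (sym (+-identityʳ B))) z≤n (inj₁ refl) (inj₂ (m≤m+n d e)) dB≤W bound
  where
  open Narrow g δ e using (N; v; d; δ*G≤)
  Fv : (2 + g) * v ≡ N + d
  Fv = eq g δ e
    where
    eq : ∀ g δ e → (2 + g) * (2 + δ + e) ≡ suc g * (2 + δ) + (2 + g) * e + (2 + δ)
    eq = solve-∀
  open Shapes N v d g (s≤s (s≤s z≤n)) (s≤s (s≤s z≤n)) (m≤n⇒m≤1+n (m≤m+n d e)) Fv
  open ≤-Reasoning
  2G≤K : 2 * G ≤ K
  2G≤K = ≤-trans (≤-reflexive (sym (Σ<-* f 2 a)))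
    (Σ<-mono f λ i i<f → *-monoˡ-≤ (a i) (⊓-glb (m≤m+n 2 δ) (2≤w i<f)))
  K≤dG : K ≤ d * G
  K≤dG = ≤-trans (Σ<-mono f λ i _ → *-monoˡ-≤ (a i) (m⊓n≤m d (w i))) (≤-reflexive (Σ<-* f d a))
  G≤B : G ≤ B
  G≤B = s≤s⁻¹ (*-cancelˡ-< d G (suc B) (begin-strict
    d * G               ≡⟨ *-distribʳ-+ G 2 δ ⟩
    2 * G + δ * G       ≤⟨ +-mono-≤ 2G≤K δ*G≤ ⟩
    K + a f             <⟨ W< ⟩
    d * B + d           ≡⟨ trans (+-comm (d * B) d) (sym (*-suc d B)) ⟩
    d * suc B           ∎))
  reduced : e * B + K ≤ a F + (G + Big) → v * B + K ≤ a F + (d * B + (G + Big))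
  reduced le = begin
    v * B + K                          ≡⟨ eq d e B K ⟩
    d * B + (e * B + K)                ≤⟨ +-monoʳ-≤ (d * B) le ⟩
    d * B + (a F + (G + Big))          ≡⟨ eq′ (d * B) (a F) (G + Big) ⟩
    a F + (d * B + (G + Big))          ∎
    where
    eq : ∀ d e B K → (d + e) * B + K ≡ d * B + (e * B + K)
    eq = solve-∀
    eq′ : ∀ x y z → x + (y + z) ≡ y + (x + z)
    eq′ = solve-∀
  bound : v * B + K ≤ a F + (d * B + (G + Big))
  bound = reduced (go δ refl)
    where
    go : ∀ δ′ → δ ≡ δ′ → e * B + K ≤ a F + (G + Big)
    go (suc δ′) refl = ≤-trans (Narrow≥3.zeros-bound g δ′ e B K K≤dG dB≤W) (+-monoʳ-≤ (a F) (m≤m+n G Big))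
    -- For d = 2 every set of size below g comes with a part larger than `F`, and these parts
    -- relieve size `F`; for d ≥ 3 `Big` is simply dropped.
    go zero     refl = begin
      e * B + K                          ≤⟨ +-monoʳ-≤ (e * B) K≤dG ⟩
      e * B + 2 * (H + a g)              ≡⟨ eq (e * B) H (a g) ⟩
      (e * B + a g) + (H + a g + H)      ≤⟨ +-mono-≤ (Narrow2.zeros-bound g e B (≤-trans dB≤W (+-monoˡ-≤ (a f) K≤dG)))
                                              (+-monoʳ-≤ (H + a g) H≤Big) ⟩
      a F + (G + Big)                    ∎
      where
      H = Σ< g a
      eq : ∀ x H y → x + 2 * (H + y) ≡ (x + y) + (H + y + H)
      eq = solve-∀
      H≤Big : H ≤ Big
      H≤Big = Σ<-mono g λ i i<g → ≤-trans (≤-reflexive (sym (*-identityʳ (a i)))) (*-monoʳ-≤ (a i)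
        (⊓-glb ≤-refl (m<n⇒0<n∸m (≤-trans (≤-reflexive (sym (m+n∸n≡m 3 i))) (∸-monoˡ-≤ i (s≤s (s≤s i<g)))))))

columns-wide : ∀ h ν B → let open Wide h ν in
  let W = Σ< (2 + h) (λ i → (d ⊓ (3 + h ∸ i)) * nonempty N i) + nonempty N (2 + h) in
  d * B ≤ W → W < d * B + d → Σ (Array N B v) IsLocating
columns-wide h ν B dB≤W W< =
  -- Every column contains a small set; the `G ∸ B` surplus ones are absorbed by pairs.
  columns B (G ∸ B) 0 G≡ (pairs-bound B K₀ P 3H≤K₀ W<′ G≡′) (P-ok ν refl) (inj₁ refl) dB≤W bound
  where
  open Wide h ν
  Fv : (3 + h) * v ≡ N + d
  Fv = eq h ν
    where
    eq : ∀ h ν → (3 + h) * (2 + ν) ≡ suc h * (2 + ν) + suc ν + (3 + ν)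
    eq = solve-∀
  open Shapes N v d (suc h) (s≤s (s≤s z≤n)) (s≤s (s≤s z≤n)) ≤-refl Fv
  open ≤-Reasoning
  K₀ P : ℕ
  K₀ = Σ< (suc h) (λ i → charge i * a i)
  P = G ∸ B
  W≡ : K + a f ≡ K₀ + d * x
  W≡ = trans (cong₂ (λ s t → K₀ + s * x + t) charge-g level-f) (eq K₀ ν x)
    where
    eq : ∀ K ν x → K + 2 * x + suc ν * x ≡ K + (3 + ν) * x
    eq = solve-∀
  K₀≤dH : K₀ ≤ d * H
  K₀≤dH = ≤-trans (Σ<-mono (suc h) λ i _ → *-monoˡ-≤ (a i) (m⊓n≤m d (w i))) (≤-reflexive (Σ<-* (suc h) d a))
  w-large : ∀ c {i} → c + i < f → 2 + c ≤ w i
  w-large c c+i<f = m+n≤o⇒m≤o∸n (2 + c) (s≤s c+i<f)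
  3H≤K₀ : 3 * H ≤ K₀
  3H≤K₀ = ≤-trans (≤-reflexive (sym (Σ<-* (suc h) 3 a)))
    (Σ<-mono (suc h) λ i i<g → *-monoˡ-≤ (a i) (⊓-glb (m≤m+n 3 ν) (w-large 1 (s≤s i<g))))
  B≤G : B ≤ G
  B≤G = *-cancelˡ-≤ d (begin
    d * B             ≤⟨ dB≤W ⟩
    K + a f           ≡⟨ W≡ ⟩
    K₀ + d * x        ≤⟨ +-monoˡ-≤ (d * x) K₀≤dH ⟩
    d * H + d * x     ≡⟨ *-distribˡ-+ d H x ⟨
    d * G             ∎)
  G≡′ : G ≡ B + P
  G≡′ = sym (m+[n∸m]≡n B≤G)
  G≡ : G + 0 ≡ B + P
  G≡ = trans (+-identityʳ G) G≡′
  W<′ : K₀ + d * x < d * B + d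
  W<′ = subst (_< d * B + d) W≡ W<
  P-ok : ∀ ν′ → ν ≡ ν′ → P ≡ 0 ⊎ 4 ≤ d
  P-ok zero     ν≡0  = inj₁ (no-pairs B K₀ P 3H≤K₀ W<′ G≡′ ν≡0)
  P-ok (suc ν′) refl = inj₂ (s≤s (s≤s (s≤s (s≤s z≤n))))
  reduced : K₀ + x ≤ a F + (B + (H + Big)) → v * B + K ≤ a F + (d * B + (G + Big))
  reduced le = begin
    v * B + (K₀ + charge (suc h) * x)        ≡⟨ cong (λ t → v * B + (K₀ + t * x)) charge-g ⟩
    v * B + (K₀ + 2 * x)                     ≡⟨ eq (v * B) K₀ x ⟩
    v * B + x + (K₀ + x)                     ≤⟨ +-monoʳ-≤ (v * B + x) le ⟩
    v * B + x + (a F + (B + (H + Big)))      ≡⟨ eq′ ν B x (a F) H Big ⟩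
    a F + (d * B + (G + Big))                ∎
    where
    eq : ∀ y K x → y + (K + 2 * x) ≡ y + x + (K + x)
    eq = solve-∀
    eq′ : ∀ ν B x y H b → (2 + ν) * B + x + (y + (B + (H + b))) ≡ y + ((3 + ν) * B + (H + x + b))
    eq′ = solve-∀
  bound : v * B + K ≤ a F + (d * B + (G + Big))
  bound = reduced (go ν refl)
    where
    go : ∀ ν′ → ν ≡ ν′ → K₀ + x ≤ a F + (B + (H + Big))
    go (suc μ) refl = begin
      K₀ + x                       ≤⟨ +-mono-≤ K₀≤dH (x≤B B K₀ P 3H≤K₀ W<′ G≡′) ⟩
      H + v * H + B                ≤⟨ +-monoˡ-≤ B (+-monoʳ-≤ H (v*H≤ h μ)) ⟩
      H + a F + B                  ≤⟨ ≤-from Big (eq H (a F) B Big) ⟩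
      a F + (B + (H + Big))        ∎
      where
      eq : ∀ H y B b → y + (B + (H + b)) ≡ H + y + B + b
      eq = solve-∀
    -- Now v = 2, d = 3 and N = 2 h + 3: there are no pairs, each set of size below h brings an
    -- oversized part, and levels h and h + 3 are complementary.
    go zero refl = begin
      K₀ + x                              ≤⟨ +-monoˡ-≤ x K₀≤dH ⟩
      3 * H + x                           ≡⟨ eq H x ⟩
      H + (H + (H + x))                   ≤⟨ +-mono-≤ H≤ (+-monoʳ-≤ H (≤-reflexive G≡B)) ⟩
      (a F + Big) + (H + B)               ≡⟨ eq′ (a F) Big H B ⟩
      a F + (B + (H + Big))               ∎
      where
      eq : ∀ H x → 3 * H + x ≡ H + (H + (H + x))
      eq = solve-∀
      eq′ : ∀ y b H B → (y + b) + (H + B) ≡ y + (B + (H + b))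
      eq′ = solve-∀
      G≡B : G ≡ B
      G≡B = trans G≡′ (trans (cong (B +_) (no-pairs B K₀ P 3H≤K₀ W<′ G≡′ refl)) (+-identityʳ B))
      eq″ : ∀ h → h + (3 + h) ≡ suc h * 2 + 1
      eq″ = solve-∀
      H≤ : H ≤ a F + Big
      H≤ = begin
        Σ< h a + a h        ≤⟨ +-mono-≤ (≤-trans (Σ<-mono h all-large) (m≤m+n _ (a h * large h)))
                                (≤-trans (nonempty≤C N h) (C-unimodal N (m≤n+m h 3) (≤-reflexive (eq″ h)))) ⟩
        Big + a F           ≡⟨ +-comm Big (a F) ⟩
        a F + Big           ∎
        where
        all-large : ∀ i → i < h → a i ≤ a i * large i
        all-large i i<h = ≤-trans (≤-reflexive (sym (*-identityʳ (a i)))) (*-monoʳ-≤ (a i)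
          (⊓-glb ≤-refl (m<n⇒0<n∸m (w-large 2 (s≤s (s≤s i<h))))))

capacity : ℕ → ℕ → ℕ → ℕ
capacity N F d = Σ< F (λ i → (d ⊓ (F ∸ i)) * nonempty N i)

locating-array : ∀ {N v} F d → 2 ≤ F → 2 ≤ v → 2 ≤ d → d ≤ suc v → v ≤ N → F * v ≡ N + d → ∀ B →
  d * B ≤ capacity N F d → capacity N F d < d * B + d → Σ (Array N B v) IsLocating
locating-array (suc zero) d (s≤s ())
locating-array {N} {v} (suc (suc g)) d 2≤F 2≤v 2≤d d≤1+v v≤N Fv B dB≤ W<
  -- The top term of the capacity, at size f, has charge 1.
  rewrite trans (cong (λ t → (d ⊓ t) * (N C suc g)) (m+n∸n≡m 1 g))
            (trans (cong (_* (N C suc g)) (m≥n⇒m⊓n≡n {d} {1} (≤-trans (s≤s z≤n) 2≤d))) (*-identityˡ (N C suc g)))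
  with m≤n⇒m<n∨m≡n d≤1+v | m≤n⇒∃[o]m+o≡n 2≤d | m≤n⇒∃[o]m+o≡n 2≤v
... | inj₁ (s≤s d≤v) | δ , refl | _ with m≤n⇒∃[o]m+o≡n d≤v
...   | e , refl with N-narrow
  where
  N-narrow : N ≡ Narrow.N g δ e
  N-narrow = +-cancelʳ-≡ (2 + δ) _ _ (trans (sym Fv) (eq g δ e))
    where
    eq : ∀ g δ e → (2 + g) * (2 + δ + e) ≡ suc g * (2 + δ) + (2 + g) * e + (2 + δ)
    eq = solve-∀
...     | refl = columns-narrow g δ e B dB≤ W<
-- For d = v + 1, f = 1 would mean v = N + 1.
locating-array {N} {v} (suc (suc zero)) d 2≤F 2≤v 2≤d d≤1+v v≤N Fv B dB≤ W< | inj₂ refl | _ | _ =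
  contradiction Fv (<⇒≢ (begin-strict
    v + (v + 0)    ≡⟨ cong (v +_) (+-identityʳ v) ⟩
    v + v          <⟨ +-monoʳ-< v ≤-refl ⟩
    v + suc v      ≤⟨ +-monoˡ-≤ (suc v) v≤N ⟩
    N + suc v      ∎))
  where open ≤-Reasoning
locating-array {N} (suc (suc (suc h))) d 2≤F 2≤v 2≤d d≤1+v v≤N Fv B dB≤ W< | inj₂ refl | _ | ν , refl with N-wide
  where
  N-wide : N ≡ Wide.N h ν
  N-wide = +-cancelʳ-≡ (3 + ν) _ _ (trans (sym Fv) (eq h ν))
    where
    eq : ∀ h ν → (3 + h) * (2 + ν) ≡ suc h * (2 + ν) + suc ν + (3 + ν)
    eq = solve-∀
... | refl = columns-wide h ν B dB≤ W<

lak : ∀ {N v} F d → 2 ≤ F → 2 ≤ v → 2 ≤ d → d ≤ suc v → v ≤ N → F * v ≡ N + d → ∀ B τ →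
  capacity N F d ≡ B * d + τ → τ < d → IsLAK N v B
lak {N} {v} F d 2≤F 2≤v 2≤d d≤1+v v≤N Fv B τ W≡ τ<d =
  locating-array F d 2≤F 2≤v 2≤d d≤1+v v≤N Fv B
    (≤-trans (≤-from τ refl) (≤-reflexive (sym W≡′))) (≤-<-trans (≤-reflexive W≡′) (+-monoʳ-< (d * B) τ<d))
  , λ k A loc → s≤s⁻¹ (*-cancelʳ-< d k (suc B) (begin-strict
      k * d              ≤⟨ upper-bound F d Fv A loc ⟩
      capacity N F d     ≡⟨ W≡ ⟩
      B * d + τ          <⟨ +-monoʳ-< (B * d) τ<d ⟩
      B * d + d          ≡⟨ +-comm (B * d) d ⟩
      suc B * d          ∎))
  where
  open ≤-Reasoning
  W≡′ : capacity N F d ≡ d * B + τ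
  W≡′ = trans W≡ (cong (_+ τ) (*-comm B d))

-- Comparison with Λ

sumTo≡Σ< : ∀ n h → sumTo n h ≡ Σ< (suc n) h
sumTo≡Σ< zero    h = refl
sumTo≡Σ< (suc n) h = cong (_+ h (suc n)) (sumTo≡Σ< n h)

bracket-true : ∀ {m n} → m ≤ n → [ m ≤ᵇ n ] ≡ 1
bracket-true z≤n       = refl
bracket-true (s≤s m≤n) = bracket-true m≤n

bracket-false : ∀ {m n} → n < m → [ m ≤ᵇ n ] ≡ 0
bracket-false {suc m} {zero}  _         = refl
bracket-false {suc m} {suc n} (s≤s n<m) = bracket-false n<m

capacity-with-empty : ∀ N F d → 1 ≤ F → Σ< F (λ i → (d ⊓ (F ∸ i)) * (N C i)) ≡ capacity N F d + d ⊓ F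
capacity-with-empty N (suc f) d _ = begin
  Σ< (suc f) (λ i → (d ⊓ (suc f ∸ i)) * (N C i))
    ≡⟨ Σ<-front f (λ i → (d ⊓ (suc f ∸ i)) * (N C i)) ⟩
  (d ⊓ suc f) * (N C 0) + rest
    ≡⟨ cong (_+ rest) (trans (cong ((d ⊓ suc f) *_) (nC0≡1 N)) (*-identityʳ (d ⊓ suc f))) ⟩
  d ⊓ suc f + rest
    ≡⟨ +-comm (d ⊓ suc f) rest ⟩
  rest + d ⊓ suc f
    ≡⟨ cong (λ t → t + rest + d ⊓ suc f) (*-zeroʳ (d ⊓ suc f)) ⟨
  (d ⊓ suc f) * 0 + rest + d ⊓ suc f
    ≡⟨ cong (_+ d ⊓ suc f) (Σ<-front f (λ i → (d ⊓ (suc f ∸ i)) * nonempty N i)) ⟨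
  capacity N (suc f) d + d ⊓ suc f ∎
  where
  open ≡-Reasoning
  rest : ℕ
  rest = Σ< f (λ i → (d ⊓ (f ∸ i)) * (N C suc i))

-- The two sums are the two branches of the minimum: `S₁` collects the sizes with f + 1 - i < d,
-- `S₂` those that are charged d.
S₁+d*S₂ : ∀ N v .{{_ : NonZero v}} → let f = Defs.f N v; d = Defs.d N v in
  S₁ N v + d * S₂ N v ≡ Σ< (f + 1) (λ i → (d ⊓ (f + 1 ∸ i)) * (N C i))
S₁+d*S₂ N v = begin
  S₁ N v + d * S₂ N v
    ≡⟨ cong₂ (λ s t → s + d * t) (sumTo≡Σ< f first) (sumTo≡Σ< f second) ⟩
  Σ< (suc f) first + d * Σ< (suc f) second
    ≡⟨ cong (Σ< (suc f) first +_) (Σ<-* (suc f) d second) ⟨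
  Σ< (suc f) first + Σ< (suc f) (λ i → d * second i)
    ≡⟨ Σ<-+ (suc f) first (λ i → d * second i) ⟨
  Σ< (suc f) (λ i → first i + d * second i)
    ≡⟨ Σ<-cong (suc f) (λ i _ → term i) ⟩
  Σ< (suc f) (λ i → (d ⊓ (f + 1 ∸ i)) * (N C i))
    ≡⟨ cong (λ n → Σ< n (λ i → (d ⊓ (f + 1 ∸ i)) * (N C i))) (+-comm 1 f) ⟩
  Σ< (f + 1) (λ i → (d ⊓ (f + 1 ∸ i)) * (N C i)) ∎
  where
  open ≡-Reasoning
  f d : ℕ
  f = Defs.f N v
  d = Defs.d N v
  first second : ℕ → ℕ
  first i  = [ f + 2 ≤ᵇ i + d ] * ((f + 1 ∸ i) * (N C i))
  second i = [ i + d ≤ᵇ f + 1 ] * (N C i)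
  term : ∀ i → first i + d * second i ≡ (d ⊓ (f + 1 ∸ i)) * (N C i)
  term i with i + d ≤? f + 1
  ... | yes le
    rewrite bracket-true le | bracket-false {f + 2} {i + d} (≤-trans (s≤s le) (≤-reflexive (sym (+-suc f 1))))
          | m≤n⇒m⊓n≡m (m+n≤o⇒m≤o∸n d (≤-trans (≤-reflexive (+-comm d i)) le)) = cong (d *_) (*-identityˡ (N C i))
  ... | no  gt
    rewrite bracket-false (≰⇒> gt) | bracket-true {f + 2} {i + d} (≤-trans (≤-reflexive (+-suc f 1)) (≰⇒> gt))
          | m≥n⇒m⊓n≡n (m≤n+o⇒m∸n≤o (f + 1) i (<⇒≤ (≰⇒> gt))) | *-zeroʳ d
    = trans (+-identityʳ _) (*-identityˡ _)

module Parameters (N v : ℕ) .{{_ : NonZero v}} (2≤v : 2 ≤ v) (v≤N : v ≤ N) where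

  f F d : ℕ
  f = Defs.f N v
  F = f + 1
  d = Defs.d N v

  f*v≤ : f * v ≤ N + 1
  f*v≤ = m/n*n≤m (N + 1) v

  <F*v : N + 1 < F * v
  <F*v = begin-strict
    N + 1                      ≡⟨ m≡m%n+[m/n]*n (N + 1) v ⟩
    (N + 1) % v + f * v        <⟨ +-monoˡ-< (f * v) (m%n<n (N + 1) v) ⟩
    v + f * v                  ≡⟨ cong (_* v) (+-comm 1 f) ⟩
    F * v                      ∎
    where open ≤-Reasoning

  Fv : F * v ≡ N + d
  Fv = sym (m+[n∸m]≡n (≤-trans (m≤m+n N 1) (<⇒≤ <F*v)))

  2≤d : 2 ≤ d
  2≤d = +-cancelˡ-≤ N 2 d (≤-trans (≤-reflexive (+-suc N 1)) (≤-trans <F*v (≤-reflexive Fv)))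

  d≤1+v : d ≤ suc v
  d≤1+v = +-cancelˡ-≤ N d (suc v) (begin
    N + d          ≡⟨ Fv ⟨
    F * v          ≡⟨ cong (_* v) (+-comm f 1) ⟩
    v + f * v      ≤⟨ +-monoʳ-≤ v f*v≤ ⟩
    v + (N + 1)    ≡⟨ eq v N ⟩
    N + suc v      ∎)
    where
    open ≤-Reasoning
    eq : ∀ v N → v + (N + 1) ≡ N + suc v
    eq = solve-∀

  2≤F : 2 ≤ F
  2≤F = +-monoˡ-≤ 1 (m≥n⇒m/n>0 (≤-trans v≤N (m≤m+n N 1)))

  W rem : ℕ
  W = capacity N F d
  rem = _%_ (S₁ N v) d {{d-nonZero N v}}

  rem<d : rem < d
  rem<d = m%n<n (S₁ N v) d {{d-nonZero N v}}

  with-empty : Σ< F (λ i → (d ⊓ (F ∸ i)) * (N C i)) ≡ W + d ⊓ F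
  with-empty = capacity-with-empty N F d (≤-trans (s≤s z≤n) 2≤F)

  Λ-division : W + d ⊓ F ≡ Λ N v * d + rem
  Λ-division = begin
    W + d ⊓ F                                   ≡⟨ with-empty ⟨
    Σ< F (λ i → (d ⊓ (F ∸ i)) * (N C i))        ≡⟨ S₁+d*S₂ N v ⟨
    S₁ N v + d * S₂ N v                         ≡⟨ cong (_+ d * S₂ N v) (m≡m%n+[m/n]*n (S₁ N v) d {{d-nonZero N v}}) ⟩
    rem + q * d + d * S₂ N v                      ≡⟨ eq rem q d (S₂ N v) ⟩
    Λ N v * d + rem                               ∎
    where
    open ≡-Reasoning
    q : ℕ
    q = _/_ (S₁ N v) d {{d-nonZero N v}}
    eq : ∀ r q d s → r + q * d + d * s ≡ (q + s) * d + r
    eq = solve-∀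

  isLAK : ∀ B τ → W ≡ B * d + τ → τ < d → IsLAK N v B
  isLAK = lak F d 2≤F 2≤v 2≤d d≤1+v v≤N Fv

  -- Taking the charge `d ⊓ F` of the empty set away from `Λ N v * d + rem` costs one multiple of
  -- `d` if it exceeds `rem`, and never more, as it is at most `d`.
  one-less : rem < d ⊓ F → Σ ℕ (λ k → IsLAK N v k × (k + 1 ≡ Λ N v))
  one-less rem< with Λ N v | Λ-division
  ... | zero  | eq = contradiction (≤-<-trans (≤-reflexive eq) rem<) (≤⇒≯ (m≤n+m (d ⊓ F) W))
  ... | suc B | eq = B , isLAK B (d + rem ∸ d ⊓ F) (+-cancelʳ-≡ (d ⊓ F) _ _ (begin
      W + d ⊓ F                            ≡⟨ eq ⟩
      d + B * d + rem                        ≡⟨ eq′ d (B * d) rem ⟩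
      B * d + (d + rem)                      ≡⟨ cong (B * d +_) (m∸n+n≡m x≤d+rem) ⟨
      B * d + (d + rem ∸ d ⊓ F + d ⊓ F)      ≡⟨ +-assoc (B * d) (d + rem ∸ d ⊓ F) (d ⊓ F) ⟨
      B * d + (d + rem ∸ d ⊓ F) + d ⊓ F      ∎))
      (+-cancelʳ-< (d ⊓ F) _ d (≤-<-trans (≤-reflexive (m∸n+n≡m x≤d+rem)) (+-monoʳ-< d rem<)))
    , +-comm B 1
    where
    open ≡-Reasoning
    eq′ : ∀ d x r → d + x + r ≡ x + (d + r)
    eq′ = solve-∀
    x≤d+rem : d ⊓ F ≤ d + rem
    x≤d+rem = ≤-trans (m⊓n≤m d F) (m≤m+n d rem)

  -- For F ≤ d no charge is truncated, so `S` is the whole sum that defines `rem`.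
  S%d : F ≤ d → _%_ (Defs.S N v) d {{d-nonZero N v}} ≡ rem
  S%d F≤d = begin
    _%_ (Defs.S N v) d {{d-nonZero N v}}          ≡⟨ cong (λ s → _%_ s d {{d-nonZero N v}}) S≡ ⟩
    _%_ (rem + Λ N v * d) d {{d-nonZero N v}}       ≡⟨ [m+kn]%n≡m%n rem (Λ N v) d {{d-nonZero N v}} ⟩
    _%_ rem d {{d-nonZero N v}}                     ≡⟨ m<n⇒m%n≡m {{d-nonZero N v}} rem<d ⟩
    rem                                             ∎
    where
    open ≡-Reasoning
    S≡ : Defs.S N v ≡ rem + Λ N v * d
    S≡ = begin
      Defs.S N v                                  ≡⟨ sumTo≡Σ< f (λ i → (F ∸ i) * (N C i)) ⟩
      Σ< (suc f) (λ i → (F ∸ i) * (N C i))        ≡⟨ cong (λ n → Σ< n (λ i → (F ∸ i) * (N C i))) (+-comm 1 f) ⟩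
      Σ< F (λ i → (F ∸ i) * (N C i))
        ≡⟨ Σ<-cong F (λ i _ → cong (_* (N C i)) (sym (m≥n⇒m⊓n≡n (≤-trans (m∸n≤m F i) F≤d)))) ⟩
      Σ< F (λ i → (d ⊓ (F ∸ i)) * (N C i))        ≡⟨ with-empty ⟩
      W + d ⊓ F                                   ≡⟨ Λ-division ⟩
      Λ N v * d + rem                               ≡⟨ +-comm (Λ N v * d) rem ⟩
      rem + Λ N v * d                               ∎

theorem6p1 : (N v : ℕ) .{{_ : NonZero v}} → 2 ≤ v → v ≤ N →
    (Condition N v → IsLAK N v (Λ N v)) ×
    (¬ Condition N v → Σ ℕ (λ k → IsLAK N v k × (k + 1 ≡ Λ N v)))
theorem6p1 N v 2≤v v≤N = at-Λ , below-Λ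
  where
  open Parameters N v 2≤v v≤N
  at-Λ : Condition N v → IsLAK N v (Λ N v)
  at-Λ (f+2≤d , x , F≤x , x≤d-1 , S≡x) = isLAK (Λ N v) (rem ∸ F) (+-cancelʳ-≡ F _ _ (begin
    W + F                        ≡⟨ cong (W +_) (m≥n⇒m⊓n≡n F≤d) ⟨
    W + d ⊓ F                    ≡⟨ Λ-division ⟩
    Λ N v * d + rem                ≡⟨ cong (Λ N v * d +_) (m∸n+n≡m F≤rem) ⟨
    Λ N v * d + (rem ∸ F + F)      ≡⟨ +-assoc (Λ N v * d) (rem ∸ F) F ⟨
    Λ N v * d + (rem ∸ F) + F      ∎))
    (≤-<-trans (m∸n≤m rem F) rem<d)
    where
    open ≡-Reasoning
    F≤d : F ≤ d
    F≤d = ≤-trans (+-monoʳ-≤ f (s≤s z≤n)) f+2≤d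
    x<d : x < d
    x<d = ≤-trans (s≤s x≤d-1) (≤-reflexive (m+[n∸m]≡n (≤-trans (s≤s z≤n) 2≤d)))
    F≤rem : F ≤ rem
    F≤rem = ≤-trans F≤x (≤-reflexive (trans (sym (m<n⇒m%n≡m {{d-nonZero N v}} x<d)) (trans (sym S≡x) (S%d F≤d))))
  below-Λ : ¬ Condition N v → Σ ℕ (λ k → IsLAK N v k × (k + 1 ≡ Λ N v))
  -- In both cases rem < d ⊓ F: for d ≤ F because rem < d, and otherwise because F ≤ rem would make
  -- `rem` itself a witness of the condition.
  below-Λ ¬cond with f + 2 ≤? d
  ... | no  d<f+2 = one-less (subst (rem <_) (sym (m≤n⇒m⊓n≡m d≤F)) rem<d)
    where
    d≤F : d ≤ F
    d≤F = s≤s⁻¹ (≤-trans (≰⇒> d<f+2) (≤-reflexive (+-suc f 1)))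
  ... | yes f+2≤d = one-less (subst (rem <_) (sym (m≥n⇒m⊓n≡n F≤d)) (≰⇒> λ F≤rem → ¬cond
    (f+2≤d , rem , F≤rem , ∸-monoˡ-≤ 1 rem<d , trans (S%d F≤d) (sym (m<n⇒m%n≡m {{d-nonZero N v}} rem<d)))))
    where
    F≤d : F ≤ d
    F≤d = ≤-trans (+-monoʳ-≤ f (s≤s z≤n)) f+2≤d
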